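{- (i) If $v=2k$ is even, then $\mathrm{A}_q(v,2)=\sum_{0\le i\le v,\ i\equiv k\ (\mathrm{mod}\ 2)}\begin{bmatrix}v\\i\end{bmatrix}_q$, and the unique set of subspaces of $\mathbb{F}_q^v$ of this size with pairwise subspace distance $\ge2$ is the set of all subspaces $X$ with $\dim X\equiv k\pmod 2$. (ii) If $v=2k+1$ is odd, then $\mathrm{A}_q(v,2)=\sum_{i\text{ even}}\begin{bmatrix}v\\i\end{bmatrix}_q=\sum_{i\text{ odd}}\begin{bmatrix}v\\i\end{bmatrix}_q$, and there are exactly two sets of subspaces of $\mathbb{F}_q^v$ of this size with pairwise distance $\ge2$, namely the set of all even-dimensional subspaces and the set of all odd-dimensional subspaces; these two codes are isomorphic.
   Context: $\mathrm{d}_{\mathrm{S}}(X,Y)=\dim(X+Y)-\dim(X\cap Y)$. $\mathrm{A}_q(v,d)$ is the maximum size of a set of subspaces of $\mathbb{F}_q^v$ with pairwise subspace distance $\geq d$. Gaussian binomial $\begin{bmatrix}n\\k\end{bmatrix}_q$ = number of $k$-dimensional subspaces of $\mathbb{F}_q^n$. Two codes are isomorphic if some $\mathrm{d}_{\mathrm{S}}$-isometry of the subspace lattice of $\mathbb{F}_q^v$ maps one onto the other. -}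

module Defs where

open import Level using (0ℓ)
open import Algebra.Structures using (IsCommutativeRing)
open import Data.Bool.Base using (Bool; true; false; T)
import Data.Bool.Properties as Bool
open import Data.Empty using (⊥-elim)
open import Data.Fin.Base using (Fin)
import Data.Fin.Properties as Fin
open import Data.List.Base
  using (List; []; _∷_; _++_; map; filter; deduplicate; length; foldr; upTo; cartesianProductWith; allFin)
open import Data.List.Extrema.Nat using (max)
import Data.List.Membership.DecSetoid as DecSetoidMembership
import Data.List.Membership.Setoid as SetoidMembership
import Data.List.Membership.Setoid.Properties as ∈ˢ
open import Data.List.Membership.Propositional using () renaming (_∈_ to _∈ˡ_)
import Data.List.Membership.Propositional.Properties as ∈ˡ
open import Data.List.Relation.Unary.All as All using (All)
open import Data.List.Relation.Unary.Any as Any using (Any; here; there)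
open import Data.List.Relation.Unary.Enumerates.Setoid using (IsEnumeration)
open import Data.Nat.ListAction using (sum)
open import Data.Nat.Base as ℕ using (ℕ; zero; suc; _∸_; _%_)
import Data.Nat.Properties as ℕ
open import Data.Product.Base using (Σ; ∃; ∃₂; _×_; _,_; proj₁; proj₂)
open import Data.Unit.Base using (tt)
open import Data.Vec.Base as Vec using (Vec; []; _∷_; zipWith; replicate)
import Data.Vec.Properties as Vec
import Data.Vec.Relation.Unary.All as VecAll
open import Function.Base using (_∘_)
open import Function.Bundles using (_↔_; Inverse; Bijection; _⇔_; mk⇔)
import Function.Properties.Inverse as Inverse
open import Relation.Binary.Bundles using (DecSetoid)
open import Relation.Binary.Definitions using (_Respects_; DecidableEquality)
import Relation.Binary.Construct.On as On
open import Relation.Binary.PropositionalEquality as ≡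
  using (_≡_; _≢_; refl; sym; trans; cong; cong₂; subst; module ≡-Reasoning)
open import Relation.Nullary using (¬_; Dec; yes; no; does; ¬?; _×-dec_; _→-dec_)
open import Relation.Nullary.Decidable using (map′; does-⇔; T?; via-injection)
open import Relation.Unary using (Pred; Decidable)

does⁺ : {P : Set} (P? : Dec P) → P → T (does P?)
does⁺ (yes _) _ = tt
does⁺ (no ¬p) p = ⊥-elim (¬p p)

does⁻ : {P : Set} (P? : Dec P) → T (does P?) → P
does⁻ (yes p) _ = p

-- `elements` may contain repetitions, which `∣_∣` below removes.
record FiniteSetoid : Set₁ where
  field
    decSetoid : DecSetoid 0ℓ 0ℓ
  open DecSetoid decSetoid public using (Carrier; _≈_; _≟_; setoid)
  field
    elements : List Carrier
    complete : IsEnumeration setoid elements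

  module _ {P : Pred Carrier 0ℓ} (resp : P Respects _≈_) (P? : Decidable P) where

    ∃? : Dec (∃ P)
    ∃? = map′ Any.satisfied
      (λ (x , px) → Any.map (λ x≈y → resp x≈y px) (complete x))
      (Any.any? P? elements)

    ∀? : Dec (∀ x → P x)
    ∀? = map′
      (λ ps x → All.lookupₛ setoid resp ps (complete x))
      (λ p → All.universal p elements)
      (All.all? P? elements)

-- Classically every subset of a finite set has decidable membership.
record Subset (S : FiniteSetoid) : Set where
  open FiniteSetoid S
  field
    to   : Carrier → Bool
    resp : ∀ {x y} → x ≈ y → to x ≡ to y

infixl 5 _⟨$⟩_
_⟨$⟩_ : ∀ {S} → Subset S → FiniteSetoid.Carrier S → Bool
_⟨$⟩_ = Subset.to

module _ {S : FiniteSetoid} where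
  open FiniteSetoid S

  infix 4 _∈_

  _∈_ : Carrier → Subset S → Set
  x ∈ A = T (A ⟨$⟩ x)

  _∈?_ : ∀ x (A : Subset S) → Dec (x ∈ A)
  x ∈? A = T? (A ⟨$⟩ x)

  ∈-resp : ∀ (A : Subset S) → (_∈ A) Respects _≈_
  ∈-resp A x≈y = subst T (Subset.resp A x≈y)

  comprehension : {P : Pred Carrier 0ℓ} → P Respects _≈_ → Decidable P → Subset S
  comprehension resp P? = record
    { to   = λ x → does (P? x)
    ; resp = λ {x} {y} x≈y → does-⇔
        (mk⇔ (resp x≈y) (resp (DecSetoid.sym decSetoid x≈y))) (P? x) (P? y)
    }

  ∣_∣ : Subset S → ℕ
  ∣ A ∣ = length (filter (_∈? A) (deduplicate _≟_ elements))

sublists : {A : Set} → List A → List (List A)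
sublists []       = [] ∷ []
sublists (x ∷ xs) = map (x ∷_) (sublists xs) ++ sublists xs

filter∈sublists : {A : Set} {P : Pred A 0ℓ} (P? : Decidable P) (xs : List A) →
                  filter P? xs ∈ˡ sublists xs
filter∈sublists P? [] = here refl
filter∈sublists P? (x ∷ xs) with does (P? x)
... | true  = ∈ˡ.∈-++⁺ˡ (∈ˡ.∈-map⁺ (x ∷_) (filter∈sublists P? xs))
... | false = ∈ˡ.∈-++⁺ʳ _ (filter∈sublists P? xs)

powerset : FiniteSetoid → FiniteSetoid
powerset S = record
  { decSetoid = record
    { Carrier = Subset S
    ; _≈_     = λ A B → ∀ x → A ⟨$⟩ x ≡ B ⟨$⟩ x
    ; isDecEquivalence = record
      { isEquivalence = record
        { refl  = λ x → refl
        ; sym   = λ A≈B x → sym (A≈B x)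
        ; trans = λ A≈B B≈C x → trans (A≈B x) (B≈C x)
        }
      ; _≟_ = λ A B → ∀? (λ x≈y eq → trans (sym (Subset.resp A x≈y)) (trans eq (Subset.resp B x≈y)))
                         (λ x → (A ⟨$⟩ x) Bool.≟ (B ⟨$⟩ x))
      } }
  ; elements = map fromList (sublists elements)
  ; complete = λ A → Any.map (λ eq x → trans (A≗ A x) (cong (λ B → B ⟨$⟩ x) eq))
      (∈ˡ.∈-map⁺ fromList (filter∈sublists (_∈? A) elements))
  }
  where
  open FiniteSetoid S
  open SetoidMembership setoid using () renaming (_∈_ to _∈ₗ_)
  open DecSetoidMembership decSetoid using () renaming (_∈?_ to _∈ₗ?_)

  fromList : List Carrier → Subset S
  fromList xs = comprehension {S} {P = _∈ₗ xs} (∈ˢ.∈-resp-≈ setoid) (_∈ₗ? xs)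

  A≗ : ∀ A x → A ⟨$⟩ x ≡ fromList (filter (_∈? A) elements) ⟨$⟩ x
  A≗ A x = does-⇔
    (mk⇔ (∈ˢ.∈-filter⁺ setoid (_∈? A) (∈-resp A) (complete x))
         (λ x∈ → proj₂ (∈ˢ.∈-filter⁻ setoid (_∈? A) (∈-resp A) {xs = elements} x∈)))
    (x ∈? A) (x ∈ₗ? _)

-- The equality of { x ∈ S | P x } ignores the proofs of P.
restrict : (S : FiniteSetoid) {P : Pred (FiniteSetoid.Carrier S) 0ℓ} →
           P Respects (FiniteSetoid._≈_ S) → Decidable P → FiniteSetoid
restrict S {P} resp P? = record
  { decSetoid = On.decSetoid decSetoid (proj₁ {B = P})
  ; elements  = select elements
  ; complete  = λ (x , px) → select-complete elements px (complete x)
  }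
  where
  open FiniteSetoid S

  select : List Carrier → List (∃ P)
  select [] = []
  select (x ∷ xs) with P? x
  ... | yes px = (x , px) ∷ select xs
  ... | no  _  = select xs

  select-complete : ∀ xs {x} → P x → Any (x ≈_) xs → Any ((x ≈_) ∘ proj₁) (select xs)
  select-complete (y ∷ xs) px x∈ with P? y
  select-complete (y ∷ xs) px (here x≈y)  | yes py = here x≈y
  select-complete (y ∷ xs) px (there x∈)  | yes py = there (select-complete xs px x∈)
  select-complete (y ∷ xs) px (here x≈y)  | no ¬py = ⊥-elim (¬py (resp x≈y px))
  select-complete (y ∷ xs) px (there x∈)  | no ¬py = select-complete xs px x∈

-- Every finite field is isomorphic to one whose equality is propositional.
record FiniteField (q : ℕ) : Set₁ where
  infixl 7 _*_
  infixl 6 _+_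
  infix  8 -_
  field
    Carrier           : Set
    _+_ _*_           : Carrier → Carrier → Carrier
    -_                : Carrier → Carrier
    0# 1#             : Carrier
    isCommutativeRing : IsCommutativeRing _≡_ _+_ _*_ -_ 0# 1#
    1≢0               : 1# ≢ 0#
    invertible        : ∀ x → x ≢ 0# → ∃ λ y → y * x ≡ 1#
    finite            : Carrier ↔ Fin q

  open IsCommutativeRing isCommutativeRing public

  _≟_ : DecidableEquality Carrier
  _≟_ = via-injection (Inverse.↔⇒↣ finite) Fin._≟_

  scalars : List Carrier
  scalars = map (Inverse.from finite) (allFin q)

  scalars-complete : ∀ x → x ∈ˡ scalars
  scalars-complete x = subst (_∈ˡ scalars) (Inverse.strictlyInverseʳ finite x)
    (∈ˡ.∈-map⁺ (Inverse.from finite) (∈ˡ.∈-allFin (Inverse.to finite x)))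

module VectorSpace {q : ℕ} (F : FiniteField q) where
  private module F = FiniteField F

  Vector : ℕ → Set
  Vector v = Vec F.Carrier v

  infixl 6 _+ᵛ_
  infixr 7 _·_
  infix  4 _≟ᵛ_

  0ᵛ : ∀ {v} → Vector v
  0ᵛ = replicate _ F.0#

  _+ᵛ_ : ∀ {v} → Vector v → Vector v → Vector v
  _+ᵛ_ = zipWith F._+_

  _·_ : ∀ {v} → F.Carrier → Vector v → Vector v
  c · x = Vec.map (c F.*_) x

  vectors : ∀ v → List (Vector v)
  vectors zero    = [] ∷ []
  vectors (suc v) = cartesianProductWith _∷_ F.scalars (vectors v)

  vectors-complete : ∀ {v} (x : Vector v) → x ∈ˡ vectors v
  vectors-complete []      = here refl
  vectors-complete (c ∷ x) =
    ∈ˡ.∈-cartesianProductWith⁺ _∷_ (F.scalars-complete c) (vectors-complete x)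

  _≟ᵛ_ : ∀ {v} → DecidableEquality (Vector v)
  _≟ᵛ_ = Vec.≡-dec F._≟_

  Vectors : ℕ → FiniteSetoid
  Vectors v = record
    { decSetoid = ≡.decSetoid (_≟ᵛ_ {v})
    ; elements  = vectors v
    ; complete  = vectors-complete
    }

  linComb : ∀ {v n} → Vector n → Vec (Vector v) n → Vector v
  linComb []       []       = 0ᵛ
  linComb (c ∷ cs) (b ∷ bs) = c · b +ᵛ linComb cs bs

  module _ {v n : ℕ} (bs : Vec (Vector v) n) where

    InSpan : Vector v → Set
    InSpan x = ∃ λ cs → linComb cs bs ≡ x

    inSpan? : Decidable InSpan
    inSpan? x = FiniteSetoid.∃? (Vectors n) (≡.resp _) (λ cs → linComb cs bs ≟ᵛ x)

    LinearlyIndependent : Set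
    LinearlyIndependent = ∀ cs → linComb cs bs ≡ 0ᵛ → cs ≡ 0ᵛ

  private
    medial : ∀ a b c d → (a F.+ b) F.+ (c F.+ d) ≡ (a F.+ c) F.+ (b F.+ d)
    medial a b c d = begin
      (a F.+ b) F.+ (c F.+ d)  ≡⟨ F.+-assoc a b (c F.+ d) ⟩
      a F.+ (b F.+ (c F.+ d))  ≡⟨ cong (a F.+_) (F.+-assoc b c d) ⟨
      a F.+ ((b F.+ c) F.+ d)  ≡⟨ cong (λ z → a F.+ (z F.+ d)) (F.+-comm b c) ⟩
      a F.+ ((c F.+ b) F.+ d)  ≡⟨ cong (a F.+_) (F.+-assoc c b d) ⟩
      a F.+ (c F.+ (b F.+ d))  ≡⟨ F.+-assoc a c (b F.+ d) ⟨
      (a F.+ c) F.+ (b F.+ d)  ∎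
      where open ≡-Reasoning

  +ᵛ-medial : ∀ {v} (a b c d : Vector v) → (a +ᵛ b) +ᵛ (c +ᵛ d) ≡ (a +ᵛ c) +ᵛ (b +ᵛ d)
  +ᵛ-medial []      []      []      []      = refl
  +ᵛ-medial (a ∷ as) (b ∷ bs) (c ∷ cs) (d ∷ ds) = cong₂ _∷_ (medial a b c d) (+ᵛ-medial as bs cs ds)

  +ᵛ-identityˡ : ∀ {v} (x : Vector v) → 0ᵛ +ᵛ x ≡ x
  +ᵛ-identityˡ = Vec.zipWith-identityˡ F.+-identityˡ

  ·-distribˡ : ∀ {v} c (x y : Vector v) → c · (x +ᵛ y) ≡ c · x +ᵛ c · y
  ·-distribˡ c []      []      = refl
  ·-distribˡ c (x ∷ xs) (y ∷ ys) = cong₂ _∷_ (F.distribˡ c x y) (·-distribˡ c xs ys)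

  ·-assoc : ∀ {v} c d (x : Vector v) → c · d · x ≡ (c F.* d) · x
  ·-assoc c d []      = refl
  ·-assoc c d (x ∷ xs) = cong₂ _∷_ (sym (F.*-assoc c d x)) (·-assoc c d xs)

  1·-identity : ∀ {v} (x : Vector v) → F.1# · x ≡ x
  1·-identity []      = refl
  1·-identity (x ∷ xs) = cong₂ _∷_ (F.*-identityˡ x) (1·-identity xs)

  0·-zero : ∀ {v} (x : Vector v) → F.0# · x ≡ 0ᵛ
  0·-zero []      = refl
  0·-zero (x ∷ xs) = cong₂ _∷_ (F.zeroˡ x) (0·-zero xs)

  ·0-zero : ∀ {v} c → c · 0ᵛ {v} ≡ 0ᵛ
  ·0-zero {zero}  c = refl
  ·0-zero {suc v} c = cong₂ _∷_ (F.zeroʳ c) (·0-zero c)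

  private
    solve : ∀ a b → a F.+ b ≡ F.0# → (F.- F.1#) F.* b ≡ a
    solve a b eq = begin
      (F.- F.1#) F.* b                         ≡⟨ F.+-identityˡ _ ⟨
      F.0# F.+ (F.- F.1#) F.* b                ≡⟨ cong (F._+ _) eq ⟨
      (a F.+ b) F.+ (F.- F.1#) F.* b           ≡⟨ F.+-assoc _ _ _ ⟩
      a F.+ (b F.+ (F.- F.1#) F.* b)           ≡⟨ cong (λ z → a F.+ (z F.+ (F.- F.1#) F.* b)) (F.*-identityˡ b) ⟨
      a F.+ (F.1# F.* b F.+ (F.- F.1#) F.* b)  ≡⟨ cong (a F.+_) (F.distribʳ b _ _) ⟨
      a F.+ (F.1# F.+ F.- F.1#) F.* b          ≡⟨ cong (λ z → a F.+ z F.* b) (F.-‿inverseʳ F.1#) ⟩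
      a F.+ F.0# F.* b                         ≡⟨ cong (a F.+_) (F.zeroˡ b) ⟩
      a F.+ F.0#                               ≡⟨ F.+-identityʳ a ⟩
      a                                        ∎
      where open ≡-Reasoning

  solveᵛ : ∀ {v} (a b : Vector v) → a +ᵛ b ≡ 0ᵛ → (F.- F.1#) · b ≡ a
  solveᵛ []       []       _  = refl
  solveᵛ (a ∷ as) (b ∷ bs) eq = cong₂ _∷_
    (solve a b (Vec.∷-injectiveˡ eq)) (solveᵛ as bs (Vec.∷-injectiveʳ eq))

  linComb-· : ∀ {v n} c (cs : Vector n) (bs : Vec (Vector v) n) →
              linComb (c · cs) bs ≡ c · linComb cs bs
  linComb-· c []       []       = sym (·0-zero c)
  linComb-· c (d ∷ cs) (b ∷ bs) = begin
    (c F.* d) · b +ᵛ linComb (c · cs) bs  ≡⟨ cong₂ _+ᵛ_ (sym (·-assoc c d b)) (linComb-· c cs bs) ⟩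
    c · d · b +ᵛ c · linComb cs bs        ≡⟨ ·-distribˡ c _ _ ⟨
    c · (d · b +ᵛ linComb cs bs)          ∎
    where open ≡-Reasoning

  linComb-0∷ : ∀ {v n} (cs : Vector n) b (bs : Vec (Vector v) n) →
               linComb (F.0# ∷ cs) (b ∷ bs) ≡ linComb cs bs
  linComb-0∷ cs b bs = trans (cong (_+ᵛ _) (0·-zero b)) (+ᵛ-identityˡ _)

  InSpan-∷ : ∀ {v n} {bs : Vec (Vector v) n} b {x} → InSpan bs x → InSpan (b ∷ bs) x
  InSpan-∷ b (cs , eq) = F.0# ∷ cs , trans (linComb-0∷ cs b _) eq

  InSpan-head : ∀ {v n} (bs : Vec (Vector v) n) b → InSpan (b ∷ bs) b
  InSpan-head {v} {n} bs b = F.1# ∷ 0ᵛ , (begin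
    F.1# · b +ᵛ linComb 0ᵛ bs                   ≡⟨ cong₂ _+ᵛ_ (1·-identity b) (cong (λ z → linComb z bs) (sym (0·-zero 0ᵛ))) ⟩
    b +ᵛ linComb (F.0# · 0ᵛ) bs                 ≡⟨ cong (b +ᵛ_) (trans (linComb-· F.0# 0ᵛ bs) (0·-zero _)) ⟩
    b +ᵛ 0ᵛ                                     ≡⟨ Vec.zipWith-identityʳ F.+-identityʳ b ⟩
    b                                           ∎)
    where open ≡-Reasoning

  independent-∷ : ∀ {v n} {bs : Vec (Vector v) n} {b} →
                  LinearlyIndependent bs → ¬ InSpan bs b → LinearlyIndependent (b ∷ bs)
  independent-∷ {bs = bs} {b} ind b∉ (c ∷ cs) eq with c F.≟ F.0#
  ... | yes refl = cong (F.0# ∷_) (ind cs (trans (sym (linComb-0∷ cs b bs)) eq))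
  ... | no c≢0 with F.invertible c c≢0
  ...   | d , dc≡1 = ⊥-elim (b∉ (d · (F.- F.1#) · cs , (begin
    linComb (d · (F.- F.1#) · cs) bs    ≡⟨ linComb-· d ((F.- F.1#) · cs) bs ⟩
    d · linComb ((F.- F.1#) · cs) bs    ≡⟨ cong (d ·_) (linComb-· (F.- F.1#) cs bs) ⟩
    d · (F.- F.1#) · linComb cs bs      ≡⟨ cong (d ·_) (solveᵛ (c · b) _ eq) ⟩
    d · c · b                           ≡⟨ ·-assoc d c b ⟩
    (d F.* c) · b                       ≡⟨ cong (_· b) dc≡1 ⟩
    F.1# · b                            ≡⟨ 1·-identity b ⟩
    b                                   ∎)))
    where open ≡-Reasoning

  record IsSubspace {v} (A : Subset (Vectors v)) : Set where
    field
      0∈       : 0ᵛ ∈ A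
      +-closed : ∀ x y → x ∈ A → y ∈ A → x +ᵛ y ∈ A
      ·-closed : ∀ c x → x ∈ A → c · x ∈ A

  module _ (v : ℕ) where
    open FiniteSetoid (Vectors v) using (∀?)
    open FiniteSetoid (powerset (Vectors v)) using (_≈_)

    isSubspace? : Decidable (IsSubspace {v})
    isSubspace? A = map′
      (λ (z , p , m) → record { 0∈ = z ; +-closed = p ; ·-closed = λ c x → All.lookup (m x) (F.scalars-complete c) })
      (λ s → let open IsSubspace s in 0∈ , +-closed , λ x → All.universal (λ c → ·-closed c x) F.scalars)
      ((0ᵛ ∈? A)
        ×-dec ∀? (≡.resp _) (λ x → ∀? (≡.resp _) λ y → (x ∈? A) →-dec ((y ∈? A) →-dec ((x +ᵛ y) ∈? A)))
        ×-dec ∀? (≡.resp _) (λ x → All.all? (λ c → (x ∈? A) →-dec ((c · x) ∈? A)) F.scalars))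

    IsSubspace-resp : IsSubspace {v} Respects _≈_
    IsSubspace-resp A≈B s = record
      { 0∈       = to 0∈
      ; +-closed = λ x y x∈ y∈ → to (+-closed x y (from x∈) (from y∈))
      ; ·-closed = λ c x x∈ → to (·-closed c x (from x∈))
      }
      where
      open IsSubspace s
      to   = λ {x} → subst T (A≈B x)
      from = λ {x} → subst T (sym (A≈B x))

  Subspaces : ℕ → FiniteSetoid
  Subspaces v = restrict (powerset (Vectors v)) (IsSubspace-resp v) (isSubspace? v)

  Subspace : ℕ → Set
  Subspace v = FiniteSetoid.Carrier (Subspaces v)

  infix 4 _≈ˢ_ _∈ˢ_

  _≈ˢ_ : ∀ {v} → Subspace v → Subspace v → Set
  _≈ˢ_ {v} = FiniteSetoid._≈_ (Subspaces v)

  _∈ˢ_ : ∀ {v} → Vector v → Subspace v → Set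
  x ∈ˢ X = x ∈ proj₁ X

  infixr 7 _⊓_
  infixr 6 _⊔_

  _⊓_ : ∀ {v} → Subspace v → Subspace v → Subspace v
  _⊓_ {v} X@(A , S) Y@(B , R) = comprehension {Vectors v} (≡.resp P) P? , record
    { 0∈       = in′ (S.0∈ , R.0∈)
    ; +-closed = λ x y x∈ y∈ → let (x₁ , x₂) = out x∈ ; (y₁ , y₂) = out y∈ in
                   in′ (S.+-closed x y x₁ y₁ , R.+-closed x y x₂ y₂)
    ; ·-closed = λ c x x∈ → let (x₁ , x₂) = out x∈ in
                   in′ (S.·-closed c x x₁ , R.·-closed c x x₂)
    }
    where
    module S = IsSubspace S
    module R = IsSubspace R
    P : Vector v → Set
    P x = x ∈ˢ X × x ∈ˢ Y
    P? : Decidable P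
    P? x = (x ∈? A) ×-dec (x ∈? B)
    in′ : ∀ {x} → P x → T (does (P? x))
    in′ {x} = does⁺ (P? x)
    out : ∀ {x} → T (does (P? x)) → P x
    out {x} = does⁻ (P? x)

  InSum : ∀ {v} → Subspace v → Subspace v → Vector v → Set
  InSum X Y z = ∃₂ λ x y → x ∈ˢ X × y ∈ˢ Y × x +ᵛ y ≡ z

  inSum? : ∀ {v} (X Y : Subspace v) → Decidable (InSum X Y)
  inSum? {v} X Y z = ∃? (≡.resp _) λ x → ∃? (≡.resp _) λ y →
    (x ∈? proj₁ X) ×-dec ((y ∈? proj₁ Y) ×-dec ((x +ᵛ y) ≟ᵛ z))
    where open FiniteSetoid (Vectors v) using (∃?)

  _⊔_ : ∀ {v} → Subspace v → Subspace v → Subspace v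
  _⊔_ {v} X@(A , S) Y@(B , R) = comprehension {Vectors v} (≡.resp (InSum X Y)) (inSum? X Y) , record
    { 0∈       = in′ (0ᵛ , 0ᵛ , S.0∈ , R.0∈ , +ᵛ-identityˡ 0ᵛ)
    ; +-closed = λ z z′ z∈ z′∈ →
        let (x , y , x∈ , y∈ , eq) = out z∈ ; (x′ , y′ , x′∈ , y′∈ , eq′) = out z′∈ in
        in′ (x +ᵛ x′ , y +ᵛ y′ , S.+-closed x x′ x∈ x′∈ , R.+-closed y y′ y∈ y′∈ ,
             trans (+ᵛ-medial x x′ y y′) (cong₂ _+ᵛ_ eq eq′))
    ; ·-closed = λ c z z∈ → let (x , y , x∈ , y∈ , eq) = out z∈ in
        in′ (c · x , c · y , S.·-closed c x x∈ , R.·-closed c y y∈ ,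
             trans (sym (·-distribˡ c x y)) (cong (c ·_) eq))
    }
    where
    module S = IsSubspace S
    module R = IsSubspace R
    in′ : ∀ {z} → InSum X Y z → T (does (inSum? X Y z))
    in′ {z} = does⁺ (inSum? X Y z)
    out : ∀ {z} → T (does (inSum? X Y z)) → InSum X Y z
    out {z} = does⁻ (inSum? X Y z)

  record Basis {v} (X : Subspace v) : Set where
    field
      size        : ℕ
      basis       : Vec (Vector v) size
      contained   : VecAll.All (_∈ˢ X) basis
      independent : LinearlyIndependent basis
      spanning    : ∀ x → x ∈ˢ X → InSpan basis x

  -- A basis exists: run through all vectors of F^v, keeping those in X
  -- that are not in the span of the ones kept so far.
  private
    keep : ∀ {v n} (x : Vector v) (bs : Vec (Vector v) n) → Bool → Dec (InSpan bs x) → ∃ (Vec (Vector v))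
    keep x bs true (no _) = _ , x ∷ bs
    keep x bs _    _      = _ , bs

    extend : ∀ {v} → Subset (Vectors v) → Vector v → ∃ (Vec (Vector v)) → ∃ (Vec (Vector v))
    extend A x (_ , bs) = keep x bs (A ⟨$⟩ x) (inSpan? bs x)

    greedy : ∀ {v} → Subset (Vectors v) → List (Vector v) → ∃ (Vec (Vector v))
    greedy A = foldr (extend A) (0 , [])

    record Good {v} (A : Subset (Vectors v)) (xs : List (Vector v)) (B : ∃ (Vec (Vector v))) : Set where
      field
        contained   : VecAll.All (_∈ A) (proj₂ B)
        independent : LinearlyIndependent (proj₂ B)
        spanning    : ∀ {x} → x ∈ˡ xs → x ∈ A → InSpan (proj₂ B) x

    extend-good : ∀ {v} (A : Subset (Vectors v)) x xs B → Good A xs B → Good A (x ∷ xs) (extend A x B)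
    extend-good A x xs (n , bs) g with A ⟨$⟩ x in eq | inSpan? bs x
    ... | false | _ = record
      { contained   = contained
      ; independent = independent
      ; spanning    = λ { (here refl) x∈ → ⊥-elim (subst T eq x∈) ; (there y∈) → spanning y∈ }
      }
      where open Good g
    ... | true | yes s = record
      { contained   = contained
      ; independent = independent
      ; spanning    = λ { (here refl) _ → s ; (there y∈) → spanning y∈ }
      }
      where open Good g
    ... | true | no ¬s = record
      { contained   = subst T (sym eq) tt VecAll.∷ contained
      ; independent = independent-∷ independent ¬s
      ; spanning    = λ { (here refl) _ → InSpan-head bs x ; (there y∈) y∈A → InSpan-∷ x (spanning y∈ y∈A) }
      }
      where open Good g

    greedy-good : ∀ {v} (A : Subset (Vectors v)) xs → Good A xs (greedy A xs)
    greedy-good A [] = record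
      { contained = VecAll.[] ; independent = λ { [] _ → refl } ; spanning = λ () }
    greedy-good A (x ∷ xs) = extend-good A x xs _ (greedy-good A xs)

    greedy-cong : ∀ {v} {A B : Subset (Vectors v)} → (∀ x → A ⟨$⟩ x ≡ B ⟨$⟩ x) →
                  ∀ xs → greedy A xs ≡ greedy B xs
    greedy-cong A≈B []       = refl
    greedy-cong {A = A} {B} A≈B (x ∷ xs) = trans
      (cong (extend A x) (greedy-cong {A = A} {B} A≈B xs))
      (cong (λ a → keep x _ a (inSpan? (proj₂ (greedy B xs)) x)) (A≈B x))

  basisOf : ∀ {v} (X : Subspace v) → Basis X
  basisOf {v} X = record
    { size        = proj₁ B
    ; basis       = proj₂ B
    ; contained   = contained
    ; independent = independent
    ; spanning    = λ x → spanning (vectors-complete x)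
    }
    where
    B = greedy (proj₁ X) (vectors v)
    open Good (greedy-good (proj₁ X) (vectors v))

  dim : ∀ {v} → Subspace v → ℕ
  dim X = Basis.size (basisOf X)

  dim-cong : ∀ {v} {X Y : Subspace v} → X ≈ˢ Y → dim X ≡ dim Y
  dim-cong {v} {X} {Y} X≈Y = cong proj₁ (greedy-cong {A = proj₁ X} {proj₁ Y} X≈Y (vectors v))

  -- Truncated subtraction is harmless, since X ⊓ Y is contained in X ⊔ Y.
  dₛ : ∀ {v} → Subspace v → Subspace v → ℕ
  dₛ X Y = dim (X ⊔ Y) ∸ dim (X ⊓ Y)

  Codes : ℕ → FiniteSetoid
  Codes v = powerset (Subspaces v)

  Code : ℕ → Set
  Code v = Subset (Subspaces v)

  infix 4 _≈ᶜ_

  _≈ᶜ_ : ∀ {v} → Code v → Code v → Set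
  _≈ᶜ_ {v} = FiniteSetoid._≈_ (Codes v)

  MinDistance≥ : ∀ {v} → ℕ → Code v → Set
  MinDistance≥ d C = ∀ X Y → X ∈ C → Y ∈ C → ¬ X ≈ˢ Y → d ℕ.≤ dₛ X Y

  ⊓-cong : ∀ {v} {X X′ Y Y′ : Subspace v} → X ≈ˢ X′ → Y ≈ˢ Y′ → X ⊓ Y ≈ˢ X′ ⊓ Y′
  ⊓-cong X≈ Y≈ x rewrite X≈ x | Y≈ x = refl

  ⊔-cong : ∀ {v} {X X′ Y Y′ : Subspace v} → X ≈ˢ X′ → Y ≈ˢ Y′ → X ⊔ Y ≈ˢ X′ ⊔ Y′
  ⊔-cong {X = X} {X′} {Y} {Y′} X≈ Y≈ z = does-⇔
    (mk⇔ (λ (x , y , x∈ , y∈ , eq) → x , y , subst T (X≈ x) x∈ , subst T (Y≈ y) y∈ , eq)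
         (λ (x , y , x∈ , y∈ , eq) → x , y , subst T (sym (X≈ x)) x∈ , subst T (sym (Y≈ y)) y∈ , eq))
    (inSum? X Y z) (inSum? X′ Y′ z)

  dₛ-cong : ∀ {v} {X X′ Y Y′ : Subspace v} → X ≈ˢ X′ → Y ≈ˢ Y′ → dₛ X Y ≡ dₛ X′ Y′
  dₛ-cong {X = X} {X′} {Y} {Y′} X≈ Y≈ = cong₂ _∸_
    (dim-cong {X = X ⊔ Y} {X′ ⊔ Y′} (⊔-cong {X = X} {X′} {Y} {Y′} X≈ Y≈))
    (dim-cong {X = X ⊓ Y} {X′ ⊓ Y′} (⊓-cong {X = X} {X′} {Y} {Y′} X≈ Y≈))

  minDistance≥? : ∀ {v} d → Decidable (MinDistance≥ {v} d)
  minDistance≥? {v} d C =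
    ∀? (λ {X} {X′} X≈ p Y X′∈ Y∈ X′≉Y → subst (d ℕ.≤_) (dₛ-cong {X = X} {X′} {Y} {Y} X≈ (λ _ → refl))
          (p Y (∈-resp C {X′} {X} (≈-sym {X} {X′} X≈) X′∈) Y∈
             (λ X≈Y → X′≉Y (λ x → trans (sym (X≈ x)) (X≈Y x)))))
       λ X →
    ∀? (λ {Y} {Y′} Y≈ p X∈ Y′∈ X≉Y′ → subst (d ℕ.≤_) (dₛ-cong {X = X} {X} {Y} {Y′} (λ _ → refl) Y≈)
          (p X∈ (∈-resp C {Y′} {Y} (≈-sym {Y} {Y′} Y≈) Y′∈)
             (λ X≈Y → X≉Y′ (λ x → trans (X≈Y x) (Y≈ x)))))
       λ Y → (X ∈? C) →-dec ((Y ∈? C) →-dec (¬? (X ≟ Y) →-dec (d ℕ.≤? dₛ X Y)))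
    where
    open FiniteSetoid (Subspaces v)
    ≈-sym : ∀ {X Y : Subspace v} → X ≈ˢ Y → Y ≈ˢ X
    ≈-sym X≈Y x = sym (X≈Y x)

  -- A_q(v, d).  The empty code has minimum distance ≥ d, so the default
  -- value 0 for the maximum of an empty list plays no role.
  A : ℕ → ℕ → ℕ
  A v d = max 0 (map (λ C → ∣ C ∣) (filter (minDistance≥? d) (FiniteSetoid.elements (Codes v))))

  byDim : ∀ {v} {P : Pred ℕ 0ℓ} → Decidable P → Code v
  byDim {v} {P} P? = comprehension {Subspaces v} {P = P ∘ dim}
    (λ {X} {Y} X≈Y → subst P (dim-cong {X = X} {Y} X≈Y)) (P? ∘ dim)

  gaussian : ℕ → ℕ → ℕ
  gaussian n k = ∣ byDim {n} (ℕ._≟ k) ∣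

  ≡?-mod2 : ∀ k → Decidable (λ i → i % 2 ≡ k % 2)
  ≡?-mod2 k i = i % 2 ℕ.≟ k % 2

  -- The sum of gaussian v i over all 0 ≤ i ≤ v with i ≡ k (mod 2).
  gaussianSum : ℕ → ℕ → ℕ
  gaussianSum v k = sum (map (gaussian v) (filter (≡?-mod2 k) (upTo (suc v))))

  parityCode : ∀ v → ℕ → Code v
  parityCode v k = byDim (≡?-mod2 k)

  record Isometry (v : ℕ) : Set where
    field
      bijection : Bijection (FiniteSetoid.setoid (Subspaces v)) (FiniteSetoid.setoid (Subspaces v))
    open Bijection bijection public using (to)
    field
      isometric : ∀ X Y → dₛ (to X) (to Y) ≡ dₛ X Y

  Isomorphic : ∀ {v} → Code v → Code v → Set
  Isomorphic {v} C D = Σ (Isometry v) λ φ →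
    ∀ Y → Y ∈ D ⇔ ∃ λ X → X ∈ C × Isometry.to φ X ≈ˢ Y

{-# OPTIONS --safe #-}
-- Let b i be the number of subspaces of dimension i and c i the number of
-- those in a code C.  Minimum distance 2 means that C contains no pair X < Y
-- with dim Y = dim X + 1.  Every X of dimension i has [v - i] covers and every
-- Y of dimension i + 1 covers [i + 1] subspaces, so counting covering pairs
-- gives  c i [v - i] + c (i+1) [i+1] ≤ b i [v - i] = b (i+1) [i+1].
--
-- If v = 2k, then [v - i] > 2 [i+1] for i < k, hence 2 c i + c (i+1) ≤ b (i+1);
-- adding these up on both sides of the middle level gives the bound, and
-- equality forces c i = 0 for i ≢ k (mod 2).
--
-- If v = 2k + 1, the inequalities read x i + x (i+1) ≤ 1 for x i = c i / b i.
-- The alternating sums w i = b i - b (i-1) + ⋯ are positive for i ≤ k and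
-- satisfy w (i-1) + w i = b i, so w is a dual solution of the linear program;
-- equality forces x i + x (i+1) = 1 for all i, and x 0 ∈ {0, 1}.
--
-- Orthogonal complement is the isometry that interchanges both optimal codes;
-- |X| |X^⊥| = q^v follows by counting the pairs x ∈ X, y with x ∙ y = 0.
module Submission where

open import Defs
open import Level using (0ℓ)
open import Algebra.Bundles using (CommutativeRing)
import Algebra.Properties.CommutativeSemigroup as CommutativeSemigroupProperties
open import Data.Bool.Base using (if_then_else_; true; false; T)
open import Data.Empty using (⊥; ⊥-elim)
open import Data.Fin.Base using (Fin) renaming (zero to fzero)
open import Data.List.Base
  using (List; []; _∷_; _∷ʳ_; _++_; map; filter; length; deduplicate; upTo; allFin; cartesianProductWith)
open import Data.List.Extrema.Nat using (max≤v⁺; v≤max⁺)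
open import Data.List.Membership.Propositional using (find) renaming (_∈_ to _∈ˡ_)
import Data.List.Membership.Propositional.Properties as ∈ˡ
open import Data.List.Properties using (length-map; length-++; length-tabulate; map-++; upTo-∷ʳ)
open import Data.List.Relation.Unary.All as All using (All; []; _∷_)
import Data.List.Relation.Unary.All.Properties as All
open import Data.List.Relation.Unary.AllPairs using ([]; _∷_)
open import Data.List.Relation.Unary.Any as Any using (Any; here; there)
import Data.List.Relation.Unary.Any.Properties as Any
import Data.List.Relation.Unary.Unique.DecSetoid.Properties as UniqueDec
import Data.List.Relation.Unary.Unique.Propositional as Unique
import Data.List.Relation.Unary.Unique.Propositional.Properties as Unique
import Data.List.Relation.Unary.Unique.Setoid as UniqueSetoid
open import Data.Nat.Base hiding (_⊓_; _⊔_)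
open import Data.Nat.ListAction using (sum)
open import Data.Nat.ListAction.Properties using (sum-++)
open import Data.Nat.Properties hiding (_≟_)
import Data.Nat.Properties as ℕ
open import Data.Nat.Tactic.RingSolver using (solve-∀)
open import Data.Product.Base using (∃; _×_; _,_; proj₁; proj₂)
open import Data.Sum.Base as Sum using (_⊎_; inj₁; inj₂)
open import Data.Vec.Base using (Vec; []; _∷_)
import Data.Vec.Properties as Vec
import Data.Vec.Relation.Unary.All as VecAll
open import Function.Base using (_∘_; id; case_of_)
open import Function.Bundles using (Inverse; Injection; _↔_; _⇔_; mk⇔)
import Function.Properties.Inverse as Inverse
open import Relation.Binary.Bundles using (DecSetoid)
open import Relation.Binary.Definitions using (Tri; tri<; tri≈; tri>)
open import Relation.Binary.PropositionalEquality as ≡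
  using (_≡_; _≢_; refl; sym; trans; cong; cong₂; subst; subst₂; module ≡-Reasoning)
open import Relation.Nullary using (¬_; Dec; yes; no; does; _×-dec_; _→-dec_; ¬?)
open import Relation.Nullary.Decidable using (does-⇔; T?; decidable-stable)
open import Relation.Unary using (Pred; Decidable)

-- The numerical extremal problems

-- Only the numbers collected in `LevelCounts` enter the extremal argument. They suffice for
-- uniqueness because every level of an optimal code turns out to be empty or full. The two parities
-- of `v` call for different bounds. For odd `v` an optimal code fills one of the two middle levels
-- and leaves the other empty. On the side of the empty one, level k - 1 is full and level k empty,
-- which is tight for x (k-1) + x k ≤ 1 but not for the cruder 2 c (k-1) + c k ≤ b k. So the odd
-- case has to keep the exact inequalities and weight them. `dim` is the length of a greedily chosen
-- basis. Its properties are obtained by counting vectors: |X| = q ^ dim X, and q ≥ 2 makes the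
-- exponent recoverable. This takes the place of an exchange argument. All arithmetic stays in ℕ:
-- denominators are multiplied out and negative terms moved to the other side, and common terms and
-- factors are cancelled at the end.

≤-tight : ∀ {a b c} → a ≤ b → b ≤ c → a ≡ c → a ≡ b × b ≡ c
≤-tight a≤b b≤c refl = ≤-antisym a≤b b≤c , ≤-antisym b≤c a≤b

+-tight : ∀ {a a′ b b′} → a ≤ a′ → b ≤ b′ → a + b ≡ a′ + b′ → a ≡ a′ × b ≡ b′
+-tight {a} {a′} {b} {b′} a≤a′ b≤b′ eq =
  let (p , r) = ≤-tight (+-monoˡ-≤ b a≤a′) (+-monoʳ-≤ a′ b≤b′) eq in
  +-cancelʳ-≡ b a a′ p , +-cancelˡ-≡ a′ b b′ r

interchange : ∀ a b c d → (a + b) + (c + d) ≡ (a + c) + (b + d)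
interchange = solve-∀

∑< : ℕ → (ℕ → ℕ) → ℕ
∑< zero    f = 0
∑< (suc n) f = ∑< n f + f n

∑<-cong : ∀ {f g} n → (∀ i → i < n → f i ≡ g i) → ∑< n f ≡ ∑< n g
∑<-cong zero    eq = refl
∑<-cong (suc n) eq = cong₂ _+_ (∑<-cong n (λ i i<n → eq i (m<n⇒m<1+n i<n))) (eq n ≤-refl)

∑<-+ : ∀ f g n → ∑< n f + ∑< n g ≡ ∑< n (λ i → f i + g i)
∑<-+ f g zero    = refl
∑<-+ f g (suc n) = trans (interchange (∑< n f) (f n) (∑< n g) (g n)) (cong (_+ (f n + g n)) (∑<-+ f g n))

-- The last `n` terms are listed from `v` downwards, so that the levels above the middle appear in
-- the order in which `reverse` numbers them.
∑<-split : ∀ f m n v → suc v ≡ m + n → ∑< (suc v) f ≡ ∑< m f + ∑< n (λ i → f (v ∸ i))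
∑<-split f m zero    v eq = trans (cong (λ z → ∑< z f) (trans eq (+-identityʳ m))) (sym (+-identityʳ _))
∑<-split f m (suc n) v eq = begin
  ∑< (suc v) f                                   ≡⟨ ∑<-split f (suc m) n v (trans eq (+-suc m n)) ⟩
  ∑< m f + f m + ∑< n (λ i → f (v ∸ i))          ≡⟨ cong (λ z → ∑< m f + f z + _) m≡ ⟩
  ∑< m f + f (v ∸ n) + ∑< n (λ i → f (v ∸ i))    ≡⟨ +-assoc (∑< m f) (f (v ∸ n)) _ ⟩
  ∑< m f + (f (v ∸ n) + ∑< n (λ i → f (v ∸ i)))  ≡⟨ cong (∑< m f +_) (+-comm (f (v ∸ n)) _) ⟩
  ∑< m f + ∑< (suc n) (λ i → f (v ∸ i))          ∎
  where
  open ≡-Reasoning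
  m≡ : m ≡ v ∸ n
  m≡ = trans (sym (m+n∸n≡m m n)) (cong (_∸ n) (suc-injective (sym (trans eq (+-suc m n)))))

-- Iverson bracket: cardinalities become sums, and double counting becomes an exchange of two sums.
⟦_⟧ : {P : Set} → Dec P → ℕ
⟦ P? ⟧ = if does P? then 1 else 0

same : ℕ → ℕ → ℕ
same k i = ⟦ i % 2 ℕ.≟ k % 2 ⟧

same-refl : ∀ k → same k k ≡ 1
same-refl zero          = refl
same-refl (suc zero)    = refl
same-refl (suc (suc k)) = same-refl k

same-suc : ∀ k → same (suc k) k ≡ 0
same-suc zero          = refl
same-suc (suc zero)    = refl
same-suc (suc (suc k)) = same-suc k

-- The level sizes of the parity code for `k`, when `b` holds the Gaussian binomials.
target : (ℕ → ℕ) → ℕ → ℕ → ℕ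
target b k i = same k i * b i

private
  double-even : ∀ m → (m + m) % 2 ≡ 0
  double-odd  : ∀ m → suc (m + m) % 2 ≡ 1
  double-even zero    = refl
  double-even (suc m) = trans (cong (λ z → suc z % 2) (+-suc m m)) (double-even m)
  double-odd zero    = refl
  double-odd (suc m) = trans (cong (λ z → suc (suc z) % 2) (+-suc m m)) (double-odd m)

%2-+ : ∀ i j m → i + j ≡ m + m → i % 2 ≡ j % 2
%2-+ zero          j m       eq = sym (trans (cong (_% 2) eq) (double-even m))
%2-+ (suc zero)    j (suc m) eq = sym (trans (cong (_% 2) (trans (suc-injective eq) (+-suc m m))) (double-odd m))
%2-+ (suc (suc i)) j (suc m) eq = %2-+ i j m (suc-injective (trans (suc-injective eq) (+-suc m m)))

-- Governs the reflection of levels: i and v - i have the same parity for even `v`, while v - i and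
-- i + 1 do for odd `v`.
same-+ : ∀ k i j m → i + j ≡ m + m → same k i ≡ same k j
same-+ k i j m eq = cong (λ z → ⟦ z ℕ.≟ k % 2 ⟧) (%2-+ i j m eq)

same-complement : ∀ k i → same k i + same k (suc i) ≡ 1
same-complement zero          zero          = refl
same-complement (suc zero)    zero          = refl
same-complement (suc (suc k)) zero          = same-complement k zero
same-complement zero          (suc zero)    = refl
same-complement (suc zero)    (suc zero)    = refl
same-complement (suc (suc k)) (suc zero)    = same-complement k (suc zero)
same-complement k             (suc (suc i)) = same-complement k i

-- The extremal problem below the middle level, even case

module Even (b c : ℕ → ℕ) where

  module Bounds (n : ℕ) (c≤b : ∀ i → i ≤ n → c i ≤ b i)
                (edge : ∀ i → i < n → 2 * c i + c (suc i) ≤ b (suc i))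
                (tight : ∀ i → i < n → 2 * c i + c (suc i) ≡ b (suc i) → c i ≡ 0) where

    -- The middle level `k` has weight one, so that adding the two halves counts every level exactly
    -- twice.
    double : (ℕ → ℕ) → ℕ → ℕ
    double f k = 2 * ∑< k f + f k

    target-refl : ∀ k → target b k k ≡ b k
    target-refl k = trans (cong (_* b k) (same-refl k)) (*-identityˡ (b k))

    target-suc : ∀ k → target b (suc k) k ≡ 0
    target-suc k = cong (_* b k) (same-suc k)

    private
      step : ∀ f k → double f (2 + k) ≡ (double f k + f k) + (2 * f (1 + k) + f (2 + k))
      step f k = lemma (∑< k f) (f k) (f (1 + k)) (f (2 + k))
        where
        lemma : ∀ s x y z → 2 * (s + x + y) + z ≡ ((2 * s + x) + x) + (2 * y + z)
        lemma = solve-∀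

      edge′ : ∀ i → i < n → 2 * c i + c (suc i) ≤ 2 * target b (suc i) i + target b (suc i) (suc i)
      edge′ i i<n = subst₂ (λ x y → 2 * c i + c (suc i) ≤ 2 * x + y) (sym (target-suc i)) (sym (target-refl (suc i))) (edge i i<n)

      tight′ : ∀ i → i < n → 2 * c i + c (suc i) ≡ 2 * target b (suc i) i + target b (suc i) (suc i) →
               c i ≡ target b (suc i) i × c (suc i) ≡ target b (suc i) (suc i)
      tight′ i i<n eq = trans ci≡0 (sym (target-suc i)) , trans (trans (cong (λ x → 2 * x + c (suc i)) (sym ci≡0)) eq₁) (sym (target-refl (suc i)))
        where
        eq₁ = trans eq (cong₂ (λ x y → 2 * x + y) (target-suc i) (target-refl (suc i)))
        ci≡0 = tight i i<n eq₁

      c≤target : ∀ k → k ≤ n → c k ≤ target b k k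
      c≤target k k≤n = subst (c k ≤_) (sym (target-refl k)) (c≤b k k≤n)

    -- The induction goes by two because `target b (2 + k)` is `target b k`. Besides `double f k`
    -- and the new edge, the sum contains one further copy of `f k`, which is controlled by c k ≤ b
    -- k.
    half-≤ : ∀ k → k ≤ n → double c k ≤ double (target b k) k
    half-≤ zero          k≤n = c≤target 0 k≤n
    half-≤ (suc zero)    k≤n = edge′ 0 k≤n
    half-≤ (suc (suc k)) k≤n = subst₂ _≤_ (sym (step c k)) (sym (step (target b k) k))
      (+-mono-≤ (+-mono-≤ (half-≤ k (<⇒≤ (<⇒≤ k≤n))) (c≤target k (<⇒≤ (<⇒≤ k≤n)))) (edge′ (suc k) k≤n))

    -- `half-≤` adds up inequalities, so equality of the totals makes each of them tight. A tight
    -- edge empties its lower level and fills its upper one; the rest is two levels down.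
    half-≡ : ∀ k → k ≤ n → double c k ≡ double (target b k) k → ∀ i → i ≤ k → c i ≡ target b k i
    half-≡ zero          k≤n eq .zero z≤n = eq
    half-≡ (suc zero)    k≤n eq i i≤1 with tight′ 0 k≤n eq
    half-≡ (suc zero)    k≤n eq zero    i≤1 | eq₀ , eq₁ = eq₀
    half-≡ (suc zero)    k≤n eq (suc zero) i≤1 | eq₀ , eq₁ = eq₁
    half-≡ (suc zero)    k≤n eq (suc (suc _)) (s≤s ()) | _
    half-≡ (suc (suc k)) k≤n eq i i≤k = below
      where
      k≤n′ = <⇒≤ (<⇒≤ k≤n)
      tight₁ = +-tight (+-mono-≤ (half-≤ k k≤n′) (c≤target k k≤n′)) (edge′ (suc k) k≤n)
                 (trans (sym (step c k)) (trans eq (step (target b k) k)))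
      tight₂ = +-tight (half-≤ k k≤n′) (c≤target k k≤n′) (proj₁ tight₁)
      top = tight′ (suc k) k≤n (proj₂ tight₁)
      below : c i ≡ target b k i
      below with m≤n⇒m<n∨m≡n i≤k
      ... | inj₂ refl = proj₂ top
      ... | inj₁ (s≤s i≤1+k) with m≤n⇒m<n∨m≡n i≤1+k
      ...   | inj₂ refl = proj₁ top
      ...   | inj₁ (s≤s i≤k′) = half-≡ k k≤n′ (proj₁ tight₂) i i≤k′

-- The weighted chain of edge inequalities, odd case

module Odd (b : ℕ → ℕ) where

  weight : ℕ → ℕ
  weight zero    = b 0
  weight (suc i) = b (suc i) ∸ weight i

  offset : ℕ → ℕ
  offset k = ∑< k weight

  module Bounds (n : ℕ) (b>0 : b 0 > 0) (b< : ∀ i → i < n → b i < b (suc i)) where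

    -- The upper bound at `i` together with b i < b (suc i) keeps the next truncated difference
    -- positive, so that it is the true difference required by `weight-+`.
    weight-bounds : ∀ i → i ≤ n → 0 < weight i × weight i ≤ b i
    weight-bounds zero    i≤n = b>0 , ≤-refl
    weight-bounds (suc i) i≤n =
      m<n⇒0<n∸m (≤-<-trans (proj₂ (weight-bounds i (<⇒≤ i≤n))) (b< i i≤n)) , m∸n≤m _ (weight i)

    weight-+ : ∀ i → i < n → weight i + weight (suc i) ≡ b (suc i)
    weight-+ i i<n = m+[n∸m]≡n (≤-trans (proj₂ (weight-bounds i (<⇒≤ i<n))) (<⇒≤ (b< i i<n)))

    b-pos : ∀ i → i ≤ n → 0 < b i
    b-pos i i≤n = <-≤-trans (proj₁ (weight-bounds i i≤n)) (proj₂ (weight-bounds i i≤n))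

    -- Each weight is paired with its successor, by `weight-+`. This evaluates the final bound,
    -- which arises as `offset k` from both halves plus one `weight k`.
    offset-+ : ∀ k → k ≤ n → offset k + offset (suc k) ≡ ∑< (suc k) b
    offset-+ zero    k≤n = refl
    offset-+ (suc k) k≤n = begin
      (O + w) + (O + w + w′)    ≡⟨ lemma O w w′ ⟩
      (O + (O + w)) + (w + w′)  ≡⟨ cong₂ _+_ (offset-+ k (<⇒≤ k≤n)) (weight-+ k k≤n) ⟩
      ∑< (suc (suc k)) b        ∎
      where
      open ≡-Reasoning
      O = offset k
      w = weight k
      w′ = weight (suc k)
      lemma : ∀ O w w′ → (O + w) + (O + w + w′) ≡ (O + (O + w)) + (w + w′)
      lemma = solve-∀

    module Chain (c : ℕ → ℕ)
                 (edge : ∀ i → i < n → c i * b (suc i) + c (suc i) * b i ≤ b i * b (suc i)) where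

      Edge : ℕ → ℕ
      Edge i = c i * b (suc i) + c (suc i) * b i

      -- lower k ≤ upper k is  c 0 + ⋯ + c k ≤ w 0 + ⋯ + w (k-1) + x k w k  for
      -- x k = c k / b k, cleared of denominators.
      lower upper : ℕ → ℕ
      lower k = b k * ∑< (suc k) c
      upper k = b k * offset k + c k * weight k

      private
        -- The induction step, multiplied by b k and with c (suc k) * weight k
        -- added on both sides.
        slack base rest : ℕ → ℕ
        slack k = c (suc k) * weight k
        base k = b k * (b (suc k) * c (suc k)) + b k * slack k
        rest k = b k * (b (suc k) * c (suc k) + b (suc k) * offset k)

        lower-step : ∀ k → b k * (lower (suc k) + slack k) ≡ b (suc k) * lower k + base k
        lower-step k = lemma (b k) (b (suc k)) (∑< (suc k) c) (c (suc k)) (weight k)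
          where
          lemma : ∀ β β′ L γ′ w → β * (β′ * (L + γ′) + γ′ * w) ≡ β′ * (β * L) + (β * (β′ * γ′) + β * (γ′ * w))
          lemma = solve-∀

        middle-step : ∀ k → b (suc k) * upper k + base k ≡ weight k * Edge k + rest k
        middle-step k = lemma (b k) (b (suc k)) (offset k) (c k) (c (suc k)) (weight k)
          where
          lemma : ∀ β β′ O γ γ′ w → β′ * (β * O + γ * w) + (β * (β′ * γ′) + β * (γ′ * w))
                  ≡ w * (γ * β′ + γ′ * β) + β * (β′ * γ′ + β′ * O)
          lemma = solve-∀

        upper-step : ∀ k → k < n → weight k * (b k * b (suc k)) + rest k ≡ b k * (upper (suc k) + slack k)
        upper-step k k<n = trans
          (cong (λ z → weight k * (b k * b (suc k)) + b k * (z * c (suc k) + b (suc k) * offset k)) (sym (weight-+ k k<n)))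
          (lemma (b k) (b (suc k)) (offset k) (c (suc k)) (weight k) (weight (suc k)))
          where
          lemma : ∀ β β′ O γ′ w w′ → w * (β * β′) + β * ((w + w′) * γ′ + β′ * O)
                  ≡ β * (β′ * (O + w) + γ′ * w′ + γ′ * w)
          lemma = solve-∀

        ih-step : ∀ k → lower k ≤ upper k → b (suc k) * lower k + base k ≤ b (suc k) * upper k + base k
        ih-step k ih = +-monoˡ-≤ (base k) (*-monoʳ-≤ (b (suc k)) ih)

        edge-step : ∀ k → k < n → weight k * Edge k + rest k ≤ weight k * (b k * b (suc k)) + rest k
        edge-step k k<n = +-monoˡ-≤ (rest k) (*-monoʳ-≤ (weight k) (edge k k<n))

      -- Since b i = w (i-1) + w i, the sum of b i x i regroups into the sum of w i (x i + x (i+1))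
      -- over i < k, plus w k x k, and each bracket is at most 1. The induction adds one edge at a
      -- time, multiplied by `weight k`.
      lower≤upper : ∀ k → k ≤ n → lower k ≤ upper k
      lower≤upper zero    k≤n = ≤-reflexive (trans (*-comm (b 0) (c 0)) (cong (_+ c 0 * b 0) (sym (*-zeroʳ (b 0)))))
      lower≤upper (suc k) k<n = +-cancelʳ-≤ (slack k) _ _
        (*-cancelˡ-≤ (b k) {{>-nonZero (b-pos k (<⇒≤ k<n))}} (begin
          b k * (lower (suc k) + slack k)             ≡⟨ lower-step k ⟩
          b (suc k) * lower k + base k                ≤⟨ ih-step k (lower≤upper k (<⇒≤ k<n)) ⟩
          b (suc k) * upper k + base k                ≡⟨ middle-step k ⟩
          weight k * Edge k + rest k                  ≤⟨ edge-step k k<n ⟩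
          weight k * (b k * b (suc k)) + rest k       ≡⟨ upper-step k k<n ⟩
          b k * (upper (suc k) + slack k)             ∎))
        where open ≤-Reasoning

      private
        tight-step : ∀ k → k < n → lower (suc k) ≡ upper (suc k) →
                     b (suc k) * lower k + base k ≡ b (suc k) * upper k + base k
                     × weight k * Edge k + rest k ≡ weight k * (b k * b (suc k)) + rest k
        tight-step k k<n eq = let (p , r) = ≤-tight (ih-step k (lower≤upper k (<⇒≤ k<n)))
                                    (subst (_≤ weight k * (b k * b (suc k)) + rest k) (sym (middle-step k)) (edge-step k k<n)) total
                              in p , trans (sym (middle-step k)) r
          where
          total = trans (sym (lower-step k)) (trans (cong (λ z → b k * (z + slack k)) eq) (sym (upper-step k k<n)))

      -- Both inequalities of the induction step become equalities. Cancelling the positive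
      -- `weight k` gives the top edge, cancelling `b (suc k)` gives the equality one level lower.
      lower≡upper⇒edges : ∀ k → k ≤ n → lower k ≡ upper k → ∀ i → i < k → Edge i ≡ b i * b (suc i)
      lower≡upper⇒edges (suc k) k<n eq i (s≤s i≤k) with m≤n⇒m<n∨m≡n i≤k
      ... | inj₁ i<k  = lower≡upper⇒edges k (<⇒≤ k<n) lower≡upper i i<k
        where
        lower≡upper : lower k ≡ upper k
        lower≡upper = *-cancelˡ-≡ _ _ (b (suc k)) {{>-nonZero (b-pos (suc k) k<n)}}
          (+-cancelʳ-≡ (base k) _ _ (proj₁ (tight-step k k<n eq)))
      ... | inj₂ refl = *-cancelˡ-≡ _ _ (weight k) {{>-nonZero (proj₁ (weight-bounds k (<⇒≤ k<n)))}}
        (+-cancelʳ-≡ (rest k) _ _ (proj₂ (tight-step k k<n eq)))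

-- q-numbers and the numerical data of a code

module _ (q : ℕ) where

  -- [n] = 1 + q + ⋯ + q ^ (n ∸ 1)
  number : ℕ → ℕ
  number zero    = 0
  number (suc n) = suc (q * number n)

  module _ (q≥2 : 2 ≤ q) where

    number-double : ∀ n → 2 * number n < number (suc n)
    number-double n = s≤s (*-monoˡ-≤ (number n) q≥2)

    number-≤-suc : ∀ n → number n ≤ number (suc n)
    number-≤-suc n = ≤-trans (m≤m+n (number n) _) (<⇒≤ (number-double n))

    number-mono-+ : ∀ m n → number n ≤ number (m + n)
    number-mono-+ zero    n = ≤-refl
    number-mono-+ (suc m) n = ≤-trans (number-mono-+ m n) (number-≤-suc (m + n))

    number-mono : ∀ {m n} → m ≤ n → number m ≤ number n
    number-mono {m} {n} m≤n = subst (λ z → number m ≤ number z) (m∸n+n≡m m≤n) (number-mono-+ (n ∸ m) m)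

  -- All that the extremal argument sees of a code: `b i` is the Gaussian binomial and `c i` the
  -- number of codewords of dimension `i`. `regular` counts covering pairs from both ends, and
  -- `edge` expresses that at most one end of each pair is a codeword.
  record LevelCounts (v : ℕ) (b c : ℕ → ℕ) : Set where
    field
      c≤b         : ∀ i → i ≤ v → c i ≤ b i
      b-zero      : b 0 ≡ 1
      palindromic : ∀ i → i ≤ v → b (v ∸ i) ≡ b i
      regular     : ∀ i → i < v → b i * number (v ∸ i) ≡ b (suc i) * number (suc i)
      edge        : ∀ i → i < v → c i * number (v ∸ i) + c (suc i) * number (suc i) ≤ b i * number (v ∸ i)

  -- The numerical shadow of orthogonal complementation: it carries results about the levels below
  -- the middle to those above.
  reverse : ∀ {v b c} → LevelCounts v b c → LevelCounts v b (λ i → c (v ∸ i))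
  reverse {v} {b} {c} L = record
    { c≤b         = λ i i≤v → subst (c (v ∸ i) ≤_) (palindromic i i≤v) (c≤b (v ∸ i) (m∸n≤m v i))
    ; b-zero      = b-zero
    ; palindromic = palindromic
    ; regular     = regular
    ; edge        = λ i i<v → let
        j   = v ∸ suc i
        j<v = ∸-monoʳ-< z<s i<v
        sj≡ = sym (+-∸-assoc 1 i<v)
        vj≡ = m∸[m∸n]≡n i<v
        open ≤-Reasoning
      in begin
        c (v ∸ i) * number (v ∸ i) + c j * number (suc i)   ≡⟨ +-comm (c (v ∸ i) * number (v ∸ i)) _ ⟩
        c j * number (suc i) + c (v ∸ i) * number (v ∸ i)   ≡⟨ cong₂ (λ x y → c j * number x + c y * number y) vj≡ sj≡ ⟨
        c j * number (v ∸ j) + c (suc j) * number (suc j)   ≤⟨ edge j j<v ⟩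
        b j * number (v ∸ j)                                ≡⟨ cong₂ (λ x y → x * number y) (palindromic (suc i) i<v) vj≡ ⟩
        b (suc i) * number (suc i)                          ≡⟨ regular i i<v ⟨
        b i * number (v ∸ i)                                ∎
    }
    where open LevelCounts L

  module Consequences (q≥2 : 2 ≤ q) {v : ℕ} {b c : ℕ → ℕ} (L : LevelCounts v b c) where
    open LevelCounts L

    b-pos : ∀ i → i ≤ v → 0 < b i
    b-pos zero    i≤v = ≤-reflexive (sym b-zero)
    b-pos (suc i) i<v with b (suc i) in eq
    ... | suc _ = z<s
    ... | zero  = ⊥-elim (<-irrefl refl (begin-strict
        0                       <⟨ *-mono-< (b-pos i (<⇒≤ i<v)) (<-≤-trans z<s (number-mono q≥2 (m<n⇒0<n∸m i<v))) ⟩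
        b i * number (v ∸ i)    ≡⟨ regular i i<v ⟩
        b (suc i) * number (suc i)  ≡⟨ cong (_* number (suc i)) eq ⟩
        0                       ∎))
      where open ≤-Reasoning

    edge′ : ∀ i → i < v → c i * number (v ∸ i) + c (suc i) * number (suc i) ≤ b (suc i) * number (suc i)
    edge′ i i<v = subst (c i * number (v ∸ i) + c (suc i) * number (suc i) ≤_) (regular i i<v) (edge i i<v)

    number-< : ∀ i → suc (suc i) ≤ v ∸ i → 2 * number (suc i) < number (v ∸ i)
    number-< i p = ≤-trans (number-double q≥2 (suc i)) (number-mono q≥2 p)

    -- In `regular` the factor next to `b i` is the larger one, so `b i` has to be the smaller
    -- count.
    b-< : ∀ i → i < v → suc (suc i) ≤ v ∸ i → b i < b (suc i)
    b-< i i<v p = ≰⇒> λ b≥ → <-irrefl (sym (regular i i<v)) (begin-strict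
      b (suc i) * number (suc i)  ≤⟨ *-monoˡ-≤ (number (suc i)) b≥ ⟩
      b i * number (suc i)        <⟨ *-monoʳ-< (b i) {{>-nonZero (b-pos i (<⇒≤ i<v))}} (≤-<-trans (m≤m+n _ _) (number-< i p)) ⟩
      b i * number (v ∸ i)        ∎)
      where open ≤-Reasoning

    -- [v - i] is at least 2 [i + 1] + 1; the extra 1 leaves the surplus `c i`, which is what forces
    -- c i = 0 in `edge-2-tight`.
    edge-2 : ∀ i → i < v → suc (suc i) ≤ v ∸ i → (2 * c i + c (suc i)) * number (suc i) + c i ≤ b (suc i) * number (suc i)
    edge-2 i i<v p = begin
      (2 * c i + c (suc i)) * number (suc i) + c i                ≡⟨ lemma (c i) (c (suc i)) (number (suc i)) ⟩
      c i * suc (2 * number (suc i)) + c (suc i) * number (suc i) ≤⟨ +-monoˡ-≤ _ (*-monoʳ-≤ (c i) (number-< i p)) ⟩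
      c i * number (v ∸ i) + c (suc i) * number (suc i)           ≤⟨ edge′ i i<v ⟩
      b (suc i) * number (suc i)                                  ∎
      where
      open ≤-Reasoning
      lemma : ∀ x y n → (2 * x + y) * n + x ≡ x * suc (2 * n) + y * n
      lemma = solve-∀

    edge-2-≤ : ∀ i → i < v → suc (suc i) ≤ v ∸ i → 2 * c i + c (suc i) ≤ b (suc i)
    edge-2-≤ i i<v p = *-cancelʳ-≤ _ _ (number (suc i)) (≤-trans (m≤m+n _ (c i)) (edge-2 i i<v p))

    edge-2-tight : ∀ i → i < v → suc (suc i) ≤ v ∸ i → 2 * c i + c (suc i) ≡ b (suc i) → c i ≡ 0
    edge-2-tight i i<v p eq = n≤0⇒n≡0 (+-cancelˡ-≤ (b (suc i) * number (suc i)) _ _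
      (subst₂ _≤_ (cong (λ z → z * number (suc i) + c i) eq) (sym (+-identityʳ _)) (edge-2 i i<v p)))

    -- This is x i + x (i+1) ≤ 1 cleared of denominators. `regular` trades [v - i] for [i + 1],
    -- which becomes a common factor to cancel.
    edge-× : ∀ i → i < v → c i * b (suc i) + c (suc i) * b i ≤ b i * b (suc i)
    edge-× i i<v = *-cancelʳ-≤ _ _ (number (suc i)) (begin
      (c i * b (suc i) + c (suc i) * b i) * n₁       ≡⟨ lemma₁ (c i) (b (suc i)) (c (suc i)) (b i) n₁ ⟩
      c i * (b (suc i) * n₁) + c (suc i) * b i * n₁  ≡⟨ cong (λ z → c i * z + c (suc i) * b i * n₁) (regular i i<v) ⟨
      c i * (b i * n₀) + c (suc i) * b i * n₁        ≡⟨ lemma₂ (c i) (c (suc i)) (b i) n₀ n₁ ⟩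
      b i * (c i * n₀ + c (suc i) * n₁)              ≤⟨ *-monoʳ-≤ (b i) (edge′ i i<v) ⟩
      b i * (b (suc i) * n₁)                         ≡⟨ *-assoc (b i) (b (suc i)) n₁ ⟨
      b i * b (suc i) * n₁                           ∎)
      where
      open ≤-Reasoning
      n₀ = number (v ∸ i)
      n₁ = number (suc i)
      lemma₁ : ∀ x y z w n → (x * y + z * w) * n ≡ x * (y * n) + z * w * n
      lemma₁ = solve-∀
      lemma₂ : ∀ x y z n m → x * (z * n) + y * z * m ≡ z * (x * n + y * m)
      lemma₂ = solve-∀

-- Even ambient dimension

module EvenCase (q : ℕ) (q≥2 : 2 ≤ q) {k v : ℕ} (v≡ : v ≡ k + k) {b c : ℕ → ℕ} (L : LevelCounts q v b c) where
  private
    k≤v : k ≤ v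
    k≤v = subst (k ≤_) (sym v≡) (m≤m+n k k)

    room : ∀ i → i < k → suc (suc i) ≤ v ∸ i
    room i i<k = subst (λ z → suc (suc i) ≤ z ∸ i) (sym v≡) (begin
      suc (suc i)    ≤⟨ s≤s i<k ⟩
      suc k          ≡⟨ +-comm 1 k ⟩
      k + 1          ≤⟨ +-monoʳ-≤ k (m<n⇒0<n∸m i<k) ⟩
      k + (k ∸ i)    ≡⟨ +-∸-assoc k (<⇒≤ i<k) ⟨
      (k + k) ∸ i    ∎)
      where open ≤-Reasoning

  -- Has its own `c`, to be used for the code and for its reversal; their lower halves are the two
  -- halves of the code.
  module Half {c : ℕ → ℕ} (L : LevelCounts q v b c) where
    open LevelCounts L
    open Consequences q q≥2 L

    private
      below : ∀ {i} → i < k → i < v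
      below i<k = <-≤-trans i<k k≤v

    open Even b c
    open Bounds k (λ i i≤k → c≤b i (≤-trans i≤k k≤v))
                  (λ i i<k → edge-2-≤ i (below i<k) (room i i<k))
                  (λ i i<k → edge-2-tight i (below i<k) (room i i<k))

    half : 2 * ∑< k c + c k ≤ 2 * ∑< k (target b k) + target b k k
    half = half-≤ k ≤-refl

    half-tight : 2 * ∑< k c + c k ≡ 2 * ∑< k (target b k) + target b k k → ∀ i → i ≤ k → c i ≡ target b k i
    half-tight = half-≡ k ≤-refl

  open LevelCounts L

  private
    module Lower = Half L
    module Upper = Half (reverse q L)

    v∸k≡k : v ∸ k ≡ k
    v∸k≡k = trans (cong (_∸ k) v≡) (m+n∸n≡m k k)

    twice : ∀ f → 2 * ∑< (suc v) f ≡ (2 * ∑< k f + f k) + (2 * ∑< k (λ i → f (v ∸ i)) + f (v ∸ k))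
    twice f = trans (cong (2 *_) (∑<-split f k (suc k) v (trans (cong suc v≡) (sym (+-suc k k)))))
      (trans (lemma (∑< k f) (∑< k (λ i → f (v ∸ i))) (f (v ∸ k)))
             (cong (λ z → (2 * ∑< k f + f z) + (2 * ∑< k (λ i → f (v ∸ i)) + f (v ∸ k))) v∸k≡k))
      where
      lemma : ∀ x y z → 2 * (x + (y + z)) ≡ (2 * x + z) + (2 * y + z)
      lemma = solve-∀

    target-reverse : ∀ i → i ≤ v → target b k (v ∸ i) ≡ target b k i
    target-reverse i i≤v = cong₂ _*_
      (same-+ k (v ∸ i) i k (trans (m∸n+n≡m i≤v) v≡)) (palindromic i i≤v)

    twice-target : 2 * ∑< (suc v) (target b k) ≡
      (2 * ∑< k (target b k) + target b k k) + (2 * ∑< k (target b k) + target b k k)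
    twice-target = trans (twice (target b k))
      (cong ((2 * ∑< k (target b k) + target b k k) +_) (cong₂ (λ x y → 2 * x + y)
        (∑<-cong k (λ i i<k → target-reverse i (≤-trans (<⇒≤ i<k) k≤v))) (target-reverse k k≤v)))

  even-bound : ∑< (suc v) c ≤ ∑< (suc v) (target b k)
  even-bound = *-cancelˡ-≤ 2 (subst₂ _≤_ (sym (twice c)) (sym twice-target) (+-mono-≤ Lower.half Upper.half))

  even-unique : ∑< (suc v) c ≡ ∑< (suc v) (target b k) → ∀ i → i ≤ v → c i ≡ target b k i
  even-unique eq i i≤v with ≤-total i k | +-tight Lower.half Upper.half
      (trans (sym (twice c)) (trans (cong (2 *_) eq) twice-target))
  ... | inj₁ i≤k | lower , _ = Lower.half-tight lower i i≤k
  ... | inj₂ k≤i | _ , upper = subst (λ z → c z ≡ target b k z) (m∸[m∸n]≡n i≤v)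
      (trans (Upper.half-tight upper (v ∸ i) (subst (v ∸ i ≤_) v∸k≡k (∸-monoʳ-≤ v k≤i)))
             (sym (target-reverse (v ∸ i) (m∸n≤m v i))))

-- Odd ambient dimension

module OddCase (q : ℕ) (q≥2 : 2 ≤ q) {k v : ℕ} (v≡ : v ≡ suc (k + k)) {b c : ℕ → ℕ} (L : LevelCounts q v b c) where
  private
    k<v : k < v
    k<v = subst (k <_) (sym v≡) (s≤s (m≤m+n k k))

    v∸k≡ : v ∸ k ≡ suc k
    v∸k≡ = trans (cong (_∸ k) v≡) (m+n∸n≡m (suc k) k)

    room : ∀ i → i < k → suc (suc i) ≤ v ∸ i
    room i i<k = begin
      suc (suc i)    ≤⟨ s≤s i<k ⟩
      suc k          ≡⟨ v∸k≡ ⟨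
      v ∸ k          ≤⟨ ∸-monoʳ-≤ v (<⇒≤ i<k) ⟩
      v ∸ i          ∎
      where open ≤-Reasoning

  open LevelCounts L

  private
    L′ = reverse q L

    module C  = Consequences q q≥2 L
    module C′ = Consequences q q≥2 L′

    c′ : ℕ → ℕ
    c′ i = c (v ∸ i)

    split : ∀ f → ∑< (suc v) f ≡ ∑< (suc k) f + ∑< (suc k) (λ i → f (v ∸ i))
    split f = ∑<-split f (suc k) (suc k) v (trans (cong suc v≡) (cong suc (sym (+-suc k k))))

    below : ∀ {i} → i < k → i < v
    below i<k = <-trans i<k k<v

    open Odd b
    open Bounds k (C.b-pos 0 z≤n) (λ i i<k → C.b-< i (below i<k) (room i i<k))
    module Lower = Chain c  (λ i i<k → C.edge-× i (below i<k))
    module Upper = Chain c′ (λ i i<k → C′.edge-× i (below i<k))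

    b-mid : b (suc k) ≡ b k
    b-mid = trans (cong b (sym v∸k≡)) (palindromic k (<⇒≤ k<v))

    bₖ≢0 : NonZero (b k)
    bₖ≢0 = >-nonZero (C.b-pos k (<⇒≤ k<v))

    middle-edge : c k * b (suc k) + c (suc k) * b k ≡ b k * (c k + c′ k)
    middle-edge = trans (cong₂ (λ x y → c k * x + c y * b k) b-mid (sym v∸k≡)) (lemma (c k) (c′ k) (b k))
      where
      lemma : ∀ x y z → x * z + y * z ≡ z * (x + y)
      lemma = solve-∀

    -- The two middle levels have equal size, so a factor `b k` cancels from the edge between them.
    -- This edge links the lower and the upper chain.
    middle-≤ : c k + c′ k ≤ b k
    middle-≤ = *-cancelˡ-≤ (b k) {{bₖ≢0}} (subst₂ _≤_ middle-edge (cong (b k *_) b-mid) (C.edge-× k k<v))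

    sides : Lower.lower k + Upper.lower k ≤ Lower.upper k + Upper.upper k
    sides = +-mono-≤ (Lower.lower≤upper k ≤-refl) (Upper.lower≤upper k ≤-refl)

    middle : b k * (offset k + offset k) + weight k * (c k + c′ k) ≤ b k * (offset k + offset k) + weight k * b k
    middle = +-monoʳ-≤ (b k * (offset k + offset k)) (*-monoʳ-≤ (weight k) middle-≤)

    total-lower : b k * ∑< (suc v) c ≡ Lower.lower k + Upper.lower k
    total-lower = trans (cong (b k *_) (split c)) (*-distribˡ-+ (b k) _ _)

    total-middle : Lower.upper k + Upper.upper k ≡ b k * (offset k + offset k) + weight k * (c k + c′ k)
    total-middle = lemma (b k) (offset k) (weight k) (c k) (c′ k)
      where
      lemma : ∀ b o w x y → (b * o + x * w) + (b * o + y * w) ≡ b * (o + o) + w * (x + y)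
      lemma = solve-∀

    total-upper : b k * (offset k + offset k) + weight k * b k ≡ b k * ∑< (suc k) b
    total-upper = trans (lemma (b k) (offset k) (weight k)) (cong (b k *_) (offset-+ k ≤-refl))
      where
      lemma : ∀ b o w → b * (o + o) + w * b ≡ b * (o + (o + w))
      lemma = solve-∀

    -- The chains leave w k x k and w k x (k+1), and the middle edge bounds their sum by w k. The
    -- resulting 2 `offset k` + `weight k` is evaluated by `offset-+`.
    odd-bound′ : ∑< (suc v) c ≤ ∑< (suc k) b
    odd-bound′ = *-cancelˡ-≤ (b k) {{bₖ≢0}} (begin
      b k * ∑< (suc v) c                                      ≡⟨ total-lower ⟩
      Lower.lower k + Upper.lower k                           ≤⟨ sides ⟩
      Lower.upper k + Upper.upper k                           ≡⟨ total-middle ⟩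
      b k * (offset k + offset k) + weight k * (c k + c′ k)   ≤⟨ middle ⟩
      b k * (offset k + offset k) + weight k * b k            ≡⟨ total-upper ⟩
      b k * ∑< (suc k) b                                      ∎)
      where open ≤-Reasoning

    Tight : ℕ → Set
    Tight i = c i * b (suc i) + c (suc i) * b i ≡ b i * b (suc i)

    mirror : ∀ i → i < v → c′ i * b (suc i) + c′ (suc i) * b i ≡ b i * b (suc i) → Tight (v ∸ suc i)
    mirror i i<v eq = begin
      c j * b (suc j) + c (suc j) * b j   ≡⟨ cong₂ (λ x y → c j * x + c y * b j) (trans (cong b sj≡) (palindromic i (<⇒≤ i<v))) sj≡ ⟩
      c j * b i + c′ i * b j              ≡⟨ cong (λ x → c j * b i + c′ i * x) (palindromic (suc i) i<v) ⟩
      c j * b i + c′ i * b (suc i)        ≡⟨ +-comm (c j * b i) _ ⟩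
      c′ i * b (suc i) + c j * b i        ≡⟨ eq ⟩
      b i * b (suc i)                     ≡⟨ *-comm (b i) (b (suc i)) ⟩
      b (suc i) * b i                     ≡⟨ cong₂ _*_ (palindromic (suc i) i<v) (trans (cong b sj≡) (palindromic i (<⇒≤ i<v))) ⟨
      b j * b (suc j)                     ∎
      where
      open ≡-Reasoning
      j = v ∸ suc i
      sj≡ : suc j ≡ v ∸ i
      sj≡ = sym (+-∸-assoc 1 i<v)

    -- Every edge enters the bound with positive weight: those below the middle through the lower
    -- chain, those above it through the upper chain read backwards, and the middle one between
    -- them.
    all-tight : ∑< (suc v) c ≡ ∑< (suc k) b → ∀ i → i < v → Tight i
    all-tight eq i i<v = cases (<-cmp i k)
      where
      outer = ≤-tight (subst (Lower.lower k + Upper.lower k ≤_) total-middle sides) middle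
        (trans (sym total-lower) (trans (cong (b k *_) eq) (sym total-upper)))
      halves = +-tight (Lower.lower≤upper k ≤-refl) (Upper.lower≤upper k ≤-refl)
        (trans (proj₁ outer) (sym total-middle))
      mid : c k + c′ k ≡ b k
      mid = *-cancelˡ-≡ _ _ (weight k) {{>-nonZero (proj₁ (weight-bounds k ≤-refl))}}
        (+-cancelˡ-≡ (b k * (offset k + offset k)) _ _ (proj₂ outer))
      cases : Tri (i < k) (i ≡ k) (k < i) → Tight i
      cases (tri< i<k _ _)  = Lower.lower≡upper⇒edges k ≤-refl (proj₁ halves) i i<k
      cases (tri≈ _ refl _) = trans middle-edge (trans (cong (b k *_) mid) (cong (b k *_) (sym b-mid)))
      cases (tri> _ _ k<i)  = subst Tight (trans (cong (v ∸_) (sym (+-∸-assoc 1 i<v))) (m∸[m∸n]≡n (<⇒≤ i<v)))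
        (mirror j (below j<k) (Upper.lower≡upper⇒edges k ≤-refl (proj₂ halves) j j<k))
        where
        j = v ∸ suc i
        j<k : j < k
        j<k = begin-strict
          v ∸ suc i    <⟨ ∸-monoʳ-< (s≤s k<i) i<v ⟩
          v ∸ suc k    ≡⟨ cong (_∸ suc k) v≡ ⟩
          (k + k) ∸ k  ≡⟨ m+n∸n≡m k k ⟩
          k            ∎
          where open ≤-Reasoning

    -- Along tight edges empty and full levels alternate.
    propagate : (∀ i → i < v → Tight i) → ∀ j → c 0 ≡ target b j 0 → ∀ i → i ≤ v → c i ≡ target b j i
    propagate tight j c₀ zero    i≤v = c₀
    propagate tight j c₀ (suc i) i<v =
      *-cancelʳ-≡ _ _ (b i) {{>-nonZero (C.b-pos i (<⇒≤ i<v))}} (+-cancelˡ-≡ (c i * b (suc i)) _ _ (begin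
        c i * b (suc i) + c (suc i) * b i                       ≡⟨ tight i i<v ⟩
        b i * b (suc i)                                         ≡⟨ *-identityˡ _ ⟨
        1 * (b i * b (suc i))                                   ≡⟨ cong (_* (b i * b (suc i))) (same-complement j i) ⟨
        (same j i + same j (suc i)) * (b i * b (suc i))         ≡⟨ lemma (same j i) (same j (suc i)) (b i) (b (suc i)) ⟩
        target b j i * b (suc i) + target b j (suc i) * b i     ≡⟨ cong (λ z → z * b (suc i) + target b j (suc i) * b i) (propagate tight j c₀ i (<⇒≤ i<v)) ⟨
        c i * b (suc i) + target b j (suc i) * b i              ∎))
      where
      open ≡-Reasoning
      lemma : ∀ s t x y → (s + t) * (x * y) ≡ s * x * y + t * y * x
      lemma = solve-∀

  -- Levels i and v - i have equal size and opposite parity, so each such pair contributes `b i`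
  -- once for either parity `j`.
  odd-target : ∀ j → ∑< (suc v) (target b j) ≡ ∑< (suc k) b
  odd-target j = trans (split (target b j)) (trans (∑<-+ (target b j) (λ i → target b j (v ∸ i)) (suc k))
    (∑<-cong (suc k) (λ i i≤k → pair i (≤-trans (s≤s⁻¹ i≤k) (<⇒≤ k<v)))))
    where
    pair : ∀ i → i ≤ v → target b j i + target b j (v ∸ i) ≡ b i
    pair i i≤v = begin
      same j i * b i + same j (v ∸ i) * b (v ∸ i)  ≡⟨ cong₂ (λ x y → same j i * b i + x * y) parity≡ (palindromic i i≤v) ⟩
      same j i * b i + same j (suc i) * b i        ≡⟨ *-distribʳ-+ (b i) (same j i) _ ⟨
      (same j i + same j (suc i)) * b i            ≡⟨ cong (_* b i) (same-complement j i) ⟩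
      1 * b i                                      ≡⟨ *-identityˡ (b i) ⟩
      b i                                          ∎
      where
      open ≡-Reasoning
      parity≡ : same j (v ∸ i) ≡ same j (suc i)
      parity≡ = same-+ j (v ∸ i) (suc i) (suc k)
        (trans (+-suc (v ∸ i) i) (cong suc (trans (m∸n+n≡m i≤v) (trans v≡ (sym (+-suc k k))))))

  odd-bound : ∀ j → ∑< (suc v) c ≤ ∑< (suc v) (target b j)
  odd-bound j = subst (∑< (suc v) c ≤_) (sym (odd-target j)) odd-bound′

  odd-unique : ∑< (suc v) c ≡ ∑< (suc v) (target b 0) →
               (∀ i → i ≤ v → c i ≡ target b 0 i) ⊎ (∀ i → i ≤ v → c i ≡ target b 1 i)
  odd-unique eq with c 0 in c₀ | subst (c 0 ≤_) b-zero (c≤b 0 z≤n)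
  ... | zero        | _ = inj₂ (propagate tight 1 c₀)
    where tight = all-tight (trans eq (odd-target 0))
  ... | suc zero    | _ = inj₁ (propagate tight 0 (trans c₀ (sym (trans (*-identityˡ (b 0)) b-zero))))
    where tight = all-tight (trans eq (odd-target 0))
  ... | suc (suc _) | s≤s ()

-- Sums over lists and finite setoids

⟦⟧-yes : {P : Set} (P? : Dec P) → P → ⟦ P? ⟧ ≡ 1
⟦⟧-yes (yes _) p = refl
⟦⟧-yes (no ¬p) p = ⊥-elim (¬p p)

⟦⟧-no : {P : Set} (P? : Dec P) → ¬ P → ⟦ P? ⟧ ≡ 0
⟦⟧-no (yes p) ¬p = ⊥-elim (¬p p)
⟦⟧-no (no _)  ¬p = refl

⟦⟧-≢0 : {P : Set} (P? : Dec P) → ⟦ P? ⟧ ≡ 1 → P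
⟦⟧-≢0 (yes p) _ = p

⟦⟧-≤1 : {P : Set} (P? : Dec P) → ⟦ P? ⟧ ≤ 1
⟦⟧-≤1 (yes _) = ≤-refl
⟦⟧-≤1 (no  _) = z≤n

⟦⟧-cong : {P Q : Set} (P? : Dec P) (Q? : Dec Q) → (P → Q) → (Q → P) → ⟦ P? ⟧ ≡ ⟦ Q? ⟧
⟦⟧-cong P? Q? to from = cong (if_then 1 else 0) (does-⇔ (mk⇔ to from) P? Q?)

⟦⟧-mono : {P Q : Set} (P? : Dec P) (Q? : Dec Q) → (P → Q) → ⟦ P? ⟧ ≤ ⟦ Q? ⟧
⟦⟧-mono (yes p) Q? to = ≤-reflexive (sym (⟦⟧-yes Q? (to p)))
⟦⟧-mono (no _)  Q? to = z≤n

⟦⟧-× : {P Q : Set} (P? : Dec P) (Q? : Dec Q) → ⟦ P? ×-dec Q? ⟧ ≡ ⟦ P? ⟧ * ⟦ Q? ⟧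
⟦⟧-× (yes _) Q? = sym (*-identityˡ ⟦ Q? ⟧)
⟦⟧-× (no _)  Q? = refl

⟦⟧-¬ : {P : Set} (P? : Dec P) → ⟦ P? ⟧ + ⟦ ¬? P? ⟧ ≡ 1
⟦⟧-¬ (yes _) = refl
⟦⟧-¬ (no _)  = refl

-- The bracket vanishes unless `P` holds, so its cofactor may be rewritten under the assumption `P`.
⟦⟧*-cong : {P : Set} (P? : Dec P) {m n : ℕ} → (P → m ≡ n) → ⟦ P? ⟧ * m ≡ ⟦ P? ⟧ * n
⟦⟧*-cong (yes p) m≡n = cong (1 *_) (m≡n p)
⟦⟧*-cong (no _)  m≡n = refl

private
  variable
    X Y : Set

∑ : List X → (X → ℕ) → ℕ
∑ xs f = sum (map f xs)

∑-cong : (xs : List X) {f g : X → ℕ} → (∀ x → f x ≡ g x) → ∑ xs f ≡ ∑ xs g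
∑-cong []       eq = refl
∑-cong (x ∷ xs) eq = cong₂ _+_ (eq x) (∑-cong xs eq)

∑-mono : (xs : List X) {f g : X → ℕ} → (∀ x → f x ≤ g x) → ∑ xs f ≤ ∑ xs g
∑-mono []       le = z≤n
∑-mono (x ∷ xs) le = +-mono-≤ (le x) (∑-mono xs le)

∑-tight : (xs : List X) {f g : X → ℕ} → (∀ x → f x ≤ g x) → ∑ xs f ≡ ∑ xs g →
          ∀ {x} → x ∈ˡ xs → f x ≡ g x
∑-tight (y ∷ xs) le eq x∈ with +-tight (le y) (∑-mono xs le) eq
∑-tight (y ∷ xs) le eq (here refl) | eq₁ , _   = eq₁
∑-tight (y ∷ xs) le eq (there x∈)  | _   , eq₂ = ∑-tight xs le eq₂ x∈

∑-+ : (xs : List X) (f g : X → ℕ) → ∑ xs (λ x → f x + g x) ≡ ∑ xs f + ∑ xs g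
∑-+ []       f g = refl
∑-+ (x ∷ xs) f g = trans (cong (f x + g x +_) (∑-+ xs f g)) (interchange (f x) (g x) (∑ xs f) (∑ xs g))

∑-*ʳ : (xs : List X) (f : X → ℕ) (c : ℕ) → ∑ xs (λ x → f x * c) ≡ ∑ xs f * c
∑-*ʳ []       f c = refl
∑-*ʳ (x ∷ xs) f c = trans (cong (f x * c +_) (∑-*ʳ xs f c)) (sym (*-distribʳ-+ c (f x) (∑ xs f)))

∑-*ˡ : (xs : List X) (f : X → ℕ) (c : ℕ) → ∑ xs (λ x → c * f x) ≡ c * ∑ xs f
∑-*ˡ xs f c = trans (∑-cong xs (λ x → *-comm c (f x))) (trans (∑-*ʳ xs f c) (*-comm (∑ xs f) c))

∑-zero : (xs : List X) → ∑ xs (λ _ → 0) ≡ 0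
∑-zero []       = refl
∑-zero (x ∷ xs) = ∑-zero xs

∑-const : (xs : List X) (c : ℕ) → ∑ xs (λ _ → c) ≡ length xs * c
∑-const []       c = refl
∑-const (x ∷ xs) c = cong (c +_) (∑-const xs c)

∑-swap : (xs : List X) (ys : List Y) (f : X → Y → ℕ) →
         ∑ xs (λ x → ∑ ys (f x)) ≡ ∑ ys (λ y → ∑ xs (λ x → f x y))
∑-swap []       ys f = sym (∑-zero ys)
∑-swap (x ∷ xs) ys f = trans (cong (∑ ys (f x) +_) (∑-swap xs ys f)) (sym (∑-+ ys (f x) _))

-- Change of variable along a bijection given as a relation. The relational form suits quotients,
-- where the image of a listed representative need not itself be listed.
∑-matching : (xs : List X) (ys : List Y) {R : X → Y → Set} (R? : ∀ x y → Dec (R x y))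
             {f : X → ℕ} {g : Y → ℕ} →
             (∀ x → ∑ ys (λ y → ⟦ R? x y ⟧) ≡ 1) → (∀ y → ∑ xs (λ x → ⟦ R? x y ⟧) ≡ 1) →
             (∀ x y → R x y → f x ≡ g y) → ∑ xs f ≡ ∑ ys g
∑-matching xs ys R? {f} {g} total₁ total₂ fg = begin
  ∑ xs f                                        ≡⟨ ∑-cong xs (λ x → sym (trans (cong (_* f x) (total₁ x)) (*-identityˡ (f x)))) ⟩
  ∑ xs (λ x → ∑ ys (λ y → ⟦ R? x y ⟧) * f x)    ≡⟨ ∑-cong xs (λ x → ∑-*ʳ ys _ (f x)) ⟨
  ∑ xs (λ x → ∑ ys (λ y → ⟦ R? x y ⟧ * f x))    ≡⟨ ∑-cong xs (λ x → ∑-cong ys (λ y → ⟦⟧*-cong (R? x y) (fg x y))) ⟩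
  ∑ xs (λ x → ∑ ys (λ y → ⟦ R? x y ⟧ * g y))    ≡⟨ ∑-swap xs ys _ ⟩
  ∑ ys (λ y → ∑ xs (λ x → ⟦ R? x y ⟧ * g y))    ≡⟨ ∑-cong ys (λ y → ∑-*ʳ xs _ (g y)) ⟩
  ∑ ys (λ y → ∑ xs (λ x → ⟦ R? x y ⟧) * g y)    ≡⟨ ∑-cong ys (λ y → trans (cong (_* g y) (total₂ y)) (*-identityˡ (g y))) ⟩
  ∑ ys g                                        ∎
  where open ≡-Reasoning

length-filter-∑ : {P : Pred X 0ℓ} (P? : Decidable P) (xs : List X) → length (filter P? xs) ≡ ∑ xs (λ x → ⟦ P? x ⟧)
length-filter-∑ P? [] = refl
length-filter-∑ P? (x ∷ xs) with does (P? x)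
... | true  = cong suc (length-filter-∑ P? xs)
... | false = length-filter-∑ P? xs

∑-filter : {P : Pred X 0ℓ} (P? : Decidable P) (f : X → ℕ) (xs : List X) → ∑ (filter P? xs) f ≡ ∑ xs (λ x → ⟦ P? x ⟧ * f x)
∑-filter P? f [] = refl
∑-filter P? f (x ∷ xs) with does (P? x)
... | true  = cong₂ _+_ (sym (*-identityˡ (f x))) (∑-filter P? f xs)
... | false = ∑-filter P? f xs

module _ (S : DecSetoid 0ℓ 0ℓ) where
  open DecSetoid S using (Carrier; _≈_; _≟_; setoid) renaming (sym to ≈-sym; trans to ≈-trans)

  ∑-δ : ∀ {xs} → UniqueSetoid.Unique setoid xs → ∀ {x} → Any (x ≈_) xs → ∑ xs (λ y → ⟦ y ≟ x ⟧) ≡ 1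
  ∑-δ {y ∷ ys} (y∉ ∷ _) {x} (here x≈y) = cong₂ _+_ (⟦⟧-yes (y ≟ x) (≈-sym x≈y)) (rest ys y∉)
    where
    rest : ∀ zs → All (λ z → ¬ y ≈ z) zs → ∑ zs (λ z → ⟦ z ≟ x ⟧) ≡ 0
    rest []       []         = refl
    rest (z ∷ zs) (y≉z ∷ y∉) = cong₂ _+_
      (⟦⟧-no (z ≟ x) (λ z≈x → y≉z (≈-sym (≈-trans z≈x x≈y)))) (rest zs y∉)
  ∑-δ {y ∷ ys} (y∉ ∷ ys!) {x} (there x∈) = cong₂ _+_
    (⟦⟧-no (y ≟ x) (λ y≈x → y∉⇒≉ ys y∉ (Any.map (≈-trans y≈x) x∈))) (∑-δ ys! x∈)
    where
    y∉⇒≉ : ∀ zs → All (λ z → ¬ y ≈ z) zs → ¬ Any (y ≈_) zs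
    y∉⇒≉ (z ∷ zs) (y≉z ∷ _) (here y≈z) = y≉z y≈z
    y∉⇒≉ (z ∷ zs) (_ ∷ y∉)  (there y∈) = y∉⇒≉ zs y∉ y∈

module Finite (S : FiniteSetoid) where
  open FiniteSetoid S
  open DecSetoid decSetoid using () renaming (refl to ≈-refl; sym to ≈-sym; trans to ≈-trans)

  -- The list on which `∣_∣` counts, with one representative of every class.
  reps : List Carrier
  reps = deduplicate _≟_ elements

  reps-complete : ∀ x → Any (x ≈_) reps
  reps-complete x = Any.deduplicate⁺ _≟_ (λ z≈y x≈y → ≈-trans x≈y (≈-sym z≈y)) (complete x)

  reps-δ : ∀ x → ∑ reps (λ y → ⟦ y ≟ x ⟧) ≡ 1
  reps-δ x = ∑-δ decSetoid (UniqueDec.deduplicate-! decSetoid elements) (reps-complete x)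

  reps-unique : {P : Pred Carrier 0ℓ} (P? : Decidable P) (x : Carrier) →
                (∀ y → P y → y ≈ x) → (∀ y → y ≈ x → P y) → ∑ reps (λ y → ⟦ P? y ⟧) ≡ 1
  reps-unique P? x to from = trans (∑-cong reps (λ y → ⟦⟧-cong (P? y) (y ≟ x) (to y) (from y))) (reps-δ x)

  ∣∣-∑ : ∀ (A : Subset S) → ∣ A ∣ ≡ ∑ reps (λ x → ⟦ _∈?_ {S} x A ⟧)
  ∣∣-∑ A = length-filter-∑ (λ x → _∈?_ {S} x A) reps

  representative : ∀ x → ∃ λ y → y ∈ˡ reps × x ≈ y
  representative x = let (y , y∈ , x≈y) = find (reps-complete x) in y , y∈ , x≈y

-- Linear algebra

T-≡ : ∀ {a b} → (T a → T b) → (T b → T a) → a ≡ b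
T-≡ {a} {b} to from = does-⇔ (mk⇔ to from) (T? a) (T? b)

length-cartesianProductWith : {A B C : Set} (f : A → B → C) (xs : List A) (ys : List B) →
                              length (cartesianProductWith f xs ys) ≡ length xs * length ys
length-cartesianProductWith f []       ys = refl
length-cartesianProductWith f (x ∷ xs) ys = trans (length-++ (map (f x) ys))
  (cong₂ _+_ (length-map (f x) ys) (length-cartesianProductWith f xs ys))

module LinearAlgebra {q : ℕ} (F : FiniteField q) where
  open VectorSpace F public
  private
    module F = FiniteField F

  private
    ring : CommutativeRing 0ℓ 0ℓ
    ring = record { isCommutativeRing = F.isCommutativeRing }

    +-interchange : ∀ a b c d → (a F.+ b) F.+ (c F.+ d) ≡ (a F.+ c) F.+ (b F.+ d)
    +-interchange = CommutativeSemigroupProperties.interchange (CommutativeRing.+-commutativeSemigroup ring)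

  scalars-! : Unique.Unique F.scalars
  scalars-! = Unique.map⁺ (Injection.injective (Inverse.↔⇒↣ (Inverse.↔-sym F.finite))) (Unique.allFin⁺ q)

  scalars-δ : ∀ a → ∑ F.scalars (λ b → ⟦ b F.≟ a ⟧) ≡ 1
  scalars-δ a = ∑-δ (≡.decSetoid F._≟_) scalars-! (F.scalars-complete a)

  length-scalars : length F.scalars ≡ q
  length-scalars = trans (length-map _ (allFin q)) (length-tabulate {n = q} id)

  q≥2 : 2 ≤ q
  q≥2 = distinct F.0# F.1# (F.1≢0 ∘ sym) F.finite
    where
    distinct : ∀ {A : Set} {n} (x y : A) → x ≢ y → A ↔ Fin n → 2 ≤ n
    distinct {n = zero} x y x≢y i = case Inverse.to i x of λ ()
    distinct {n = suc zero} x y x≢y i with Inverse.to i x in eq | Inverse.to i y in eq′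
    ... | fzero | fzero = ⊥-elim (x≢y (Injection.injective (Inverse.↔⇒↣ i) (trans eq (sym eq′))))
    distinct {n = suc (suc n)} x y x≢y i = s≤s (s≤s z≤n)

  vectors-! : ∀ v → Unique.Unique (vectors v)
  vectors-! zero    = [] ∷ []
  vectors-! (suc v) = Unique.cartesianProductWith⁺ _∷_ Vec.∷-injective scalars-! (vectors-! v)

  vectors-δ : ∀ {v} (x : Vector v) → ∑ (vectors v) (λ y → ⟦ y ≟ᵛ x ⟧) ≡ 1
  vectors-δ {v} x = ∑-δ (≡.decSetoid _≟ᵛ_) (vectors-! v) (vectors-complete x)

  vectors-unique : ∀ {v} {P : Vector v → Set} (P? : ∀ y → Dec (P y)) (x : Vector v) →
                   (∀ y → P y → y ≡ x) → P x → ∑ (vectors v) (λ y → ⟦ P? y ⟧) ≡ 1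
  vectors-unique {v} {P} P? x to px = trans
    (∑-cong (vectors v) (λ y → ⟦⟧-cong (P? y) (y ≟ᵛ x) (to y) (λ { refl → px }))) (vectors-δ x)

  length-vectors : ∀ v → length (vectors v) ≡ q ^ v
  length-vectors zero    = refl
  length-vectors (suc v) = trans (length-cartesianProductWith _∷_ F.scalars (vectors v))
    (cong₂ _*_ length-scalars (length-vectors v))

  -ᵛ_ : ∀ {v} → Vector v → Vector v
  -ᵛ x = (F.- F.1#) · x

  +ᵛ-assoc : ∀ {v} (x y z : Vector v) → (x +ᵛ y) +ᵛ z ≡ x +ᵛ (y +ᵛ z)
  +ᵛ-assoc = Vec.zipWith-assoc F.+-assoc

  +ᵛ-identityʳ : ∀ {v} (x : Vector v) → x +ᵛ 0ᵛ ≡ x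
  +ᵛ-identityʳ = Vec.zipWith-identityʳ F.+-identityʳ

  +ᵛ-comm : ∀ {v} (x y : Vector v) → x +ᵛ y ≡ y +ᵛ x
  +ᵛ-comm = Vec.zipWith-comm F.+-comm

  ·-distribʳ : ∀ {v} c d (x : Vector v) → (c F.+ d) · x ≡ c · x +ᵛ d · x
  ·-distribʳ c d []       = refl
  ·-distribʳ c d (x ∷ xs) = cong₂ _∷_ (F.distribʳ x c d) (·-distribʳ c d xs)

  -ᵛ-inverseʳ : ∀ {v} (x : Vector v) → x +ᵛ (-ᵛ x) ≡ 0ᵛ
  -ᵛ-inverseʳ x = begin
    x +ᵛ (-ᵛ x)                    ≡⟨ cong (_+ᵛ (-ᵛ x)) (1·-identity x) ⟨
    F.1# · x +ᵛ (F.- F.1#) · x     ≡⟨ ·-distribʳ F.1# (F.- F.1#) x ⟨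
    (F.1# F.+ F.- F.1#) · x        ≡⟨ cong (_· x) (F.-‿inverseʳ F.1#) ⟩
    F.0# · x                       ≡⟨ 0·-zero x ⟩
    0ᵛ                             ∎
    where open ≡-Reasoning

  -ᵛ-inverseˡ : ∀ {v} (x : Vector v) → (-ᵛ x) +ᵛ x ≡ 0ᵛ
  -ᵛ-inverseˡ x = trans (+ᵛ-comm (-ᵛ x) x) (-ᵛ-inverseʳ x)

  +-ᵛ : ∀ {v} (x t : Vector v) → (x +ᵛ t) +ᵛ (-ᵛ t) ≡ x
  +-ᵛ x t = trans (+ᵛ-assoc x t (-ᵛ t)) (trans (cong (x +ᵛ_) (-ᵛ-inverseʳ t)) (+ᵛ-identityʳ x))

  -ᵛ+ : ∀ {v} (x t : Vector v) → (x +ᵛ (-ᵛ t)) +ᵛ t ≡ x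
  -ᵛ+ x t = trans (+ᵛ-assoc x (-ᵛ t) t) (trans (cong (x +ᵛ_) (-ᵛ-inverseˡ t)) (+ᵛ-identityʳ x))

  -ᵛ≡0 : ∀ {v} (x y : Vector v) → x +ᵛ (-ᵛ y) ≡ 0ᵛ → x ≡ y
  -ᵛ≡0 x y eq = trans (sym (-ᵛ+ x y)) (trans (cong (_+ᵛ y) eq) (+ᵛ-identityˡ y))

  ∑-translate : ∀ {v} (t : Vector v) (f : Vector v → ℕ) → ∑ (vectors v) (λ x → f (x +ᵛ t)) ≡ ∑ (vectors v) f
  ∑-translate {v} t f = ∑-matching (vectors v) (vectors v) (λ x y → y ≟ᵛ (x +ᵛ t))
    (λ x → vectors-δ (x +ᵛ t))
    (λ y → vectors-unique (λ x → y ≟ᵛ (x +ᵛ t)) (y +ᵛ (-ᵛ t))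
      (λ x y≡ → trans (sym (+-ᵛ x t)) (cong (_+ᵛ (-ᵛ t)) (sym y≡))) (sym (-ᵛ+ y t)))
    (λ x y y≡ → cong f (sym y≡))

  infix 7 _∙_
  _∙_ : ∀ {v} → Vector v → Vector v → F.Carrier
  []       ∙ []       = F.0#
  (x ∷ xs) ∙ (y ∷ ys) = x F.* y F.+ xs ∙ ys

  ∙-comm : ∀ {v} (x y : Vector v) → x ∙ y ≡ y ∙ x
  ∙-comm []       []       = refl
  ∙-comm (x ∷ xs) (y ∷ ys) = cong₂ F._+_ (F.*-comm x y) (∙-comm xs ys)

  ∙-zeroʳ : ∀ {v} (x : Vector v) → x ∙ 0ᵛ ≡ F.0#
  ∙-zeroʳ []       = refl
  ∙-zeroʳ (x ∷ xs) = trans (cong₂ F._+_ (F.zeroʳ x) (∙-zeroʳ xs)) (F.+-identityˡ F.0#)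

  ∙-distribʳ : ∀ {v} (z x y : Vector v) → (x +ᵛ y) ∙ z ≡ x ∙ z F.+ y ∙ z
  ∙-distribʳ []       []       []       = sym (F.+-identityˡ F.0#)
  ∙-distribʳ (z ∷ zs) (x ∷ xs) (y ∷ ys) = trans
    (cong₂ F._+_ (F.distribʳ z x y) (∙-distribʳ zs xs ys)) (+-interchange (x F.* z) (y F.* z) (xs ∙ zs) (ys ∙ zs))

  ·-∙ : ∀ {v} c (x y : Vector v) → (c · x) ∙ y ≡ c F.* (x ∙ y)
  ·-∙ c []       []       = sym (F.zeroʳ c)
  ·-∙ c (x ∷ xs) (y ∷ ys) = trans (cong₂ F._+_ (F.*-assoc c x y) (·-∙ c xs ys)) (sym (F.distribˡ c _ _))

  -- The witness is the unit vector at the first non-zero coordinate of `x`.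
  nondegenerate : ∀ {v} (x : Vector v) → x ≢ 0ᵛ → ∃ λ y → x ∙ y ≢ F.0#
  nondegenerate []       x≢0 = ⊥-elim (x≢0 refl)
  nondegenerate (x ∷ xs) x≢0 with x F.≟ F.0#
  ... | no x≢0 = F.1# ∷ 0ᵛ , λ eq → x≢0 (begin
        x                            ≡⟨ F.+-identityʳ x ⟨
        x F.+ F.0#                   ≡⟨ cong₂ F._+_ (F.*-identityʳ x) (∙-zeroʳ xs) ⟨
        x F.* F.1# F.+ xs ∙ 0ᵛ       ≡⟨ eq ⟩
        F.0#                         ∎)
    where open ≡-Reasoning
  ... | yes refl = let (y , xs∙y≢0) = nondegenerate xs (λ xs≡0 → x≢0 (cong (F.0# ∷_) xs≡0)) in
        F.0# ∷ y , λ eq → xs∙y≢0 (begin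
        xs ∙ y                          ≡⟨ F.+-identityˡ _ ⟨
        F.0# F.+ xs ∙ y                 ≡⟨ cong (F._+ xs ∙ y) (F.zeroʳ F.0#) ⟨
        F.0# F.* F.0# F.+ xs ∙ y        ≡⟨ eq ⟩
        F.0#                            ∎)
    where open ≡-Reasoning

  infix 4 _∈ˢ?_ _⊆_ _⊆?_

  _∈ˢ?_ : ∀ {v} (x : Vector v) (X : Subspace v) → Dec (x ∈ˢ X)
  x ∈ˢ? X = x ∈? proj₁ X

  _⊆_ : ∀ {v} → Subspace v → Subspace v → Set
  X ⊆ Y = ∀ x → x ∈ˢ X → x ∈ˢ Y

  _⊆?_ : ∀ {v} (X Y : Subspace v) → Dec (X ⊆ Y)
  _⊆?_ {v} X Y = FiniteSetoid.∀? (Vectors v) (≡.resp _) (λ x → (x ∈ˢ? X) →-dec (x ∈ˢ? Y))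

  ⊆-antisym : ∀ {v} (X Y : Subspace v) → X ⊆ Y → Y ⊆ X → X ≈ˢ Y
  ⊆-antisym X Y X⊆Y Y⊆X x = T-≡ (X⊆Y x) (Y⊆X x)

  ≈⇒⊆ : ∀ {v} (X Y : Subspace v) → X ≈ˢ Y → X ⊆ Y
  ≈⇒⊆ X Y X≈Y x = subst T (X≈Y x)

  size : ∀ {v} → Subspace v → ℕ
  size {v} X = ∑ (vectors v) (λ x → ⟦ x ∈ˢ? X ⟧)

  size-mono : ∀ {v} (X Y : Subspace v) → X ⊆ Y → size X ≤ size Y
  size-mono {v} X Y X⊆Y = ∑-mono (vectors v) (λ x → ⟦⟧-mono (x ∈ˢ? X) (x ∈ˢ? Y) (X⊆Y x))

  size-tight : ∀ {v} (X Y : Subspace v) → X ⊆ Y → size X ≡ size Y → X ≈ˢ Y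
  size-tight {v} X Y X⊆Y eq = ⊆-antisym X Y X⊆Y λ x x∈Y → ⟦⟧-≢0 (x ∈ˢ? X)
    (trans (∑-tight (vectors v) (λ z → ⟦⟧-mono (z ∈ˢ? X) (z ∈ˢ? Y) (X⊆Y z)) eq (vectors-complete x))
           (⟦⟧-yes (x ∈ˢ? Y) x∈Y))

  linComb-+ : ∀ {v n} (cs ds : Vector n) (bs : Vec (Vector v) n) →
              linComb (cs +ᵛ ds) bs ≡ linComb cs bs +ᵛ linComb ds bs
  linComb-+ []       []       []       = sym (+ᵛ-identityˡ 0ᵛ)
  linComb-+ (c ∷ cs) (d ∷ ds) (b ∷ bs) = trans
    (cong₂ _+ᵛ_ (·-distribʳ c d b) (linComb-+ cs ds bs)) (+ᵛ-medial (c · b) (d · b) _ _)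

  linComb-0 : ∀ {v n} (bs : Vec (Vector v) n) → linComb 0ᵛ bs ≡ 0ᵛ
  linComb-0 []       = refl
  linComb-0 (b ∷ bs) = trans (linComb-0∷ 0ᵛ b bs) (linComb-0 bs)

  linComb-∈ : ∀ {v n} (X : Subspace v) {bs : Vec (Vector v) n} → VecAll.All (_∈ˢ X) bs → ∀ cs → linComb cs bs ∈ˢ X
  linComb-∈ X VecAll.[]          []       = IsSubspace.0∈ (proj₂ X)
  linComb-∈ X (b∈ VecAll.∷ bs∈) (c ∷ cs) = IsSubspace.+-closed (proj₂ X) _ _
    (IsSubspace.·-closed (proj₂ X) c _ b∈) (linComb-∈ X bs∈ cs)

  Span : ∀ {v n} → Vec (Vector v) n → Subspace v
  Span {v} bs = comprehension {Vectors v} (≡.resp (InSpan bs)) (inSpan? bs) , record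
    { 0∈       = does⁺ (inSpan? bs 0ᵛ) (0ᵛ , linComb-0 bs)
    ; +-closed = λ x y x∈ y∈ → let (cs , eq) = does⁻ (inSpan? bs x) x∈ ; (ds , eq′) = does⁻ (inSpan? bs y) y∈ in
        does⁺ (inSpan? bs (x +ᵛ y)) (cs +ᵛ ds , trans (linComb-+ cs ds bs) (cong₂ _+ᵛ_ eq eq′))
    ; ·-closed = λ c x x∈ → let (cs , eq) = does⁻ (inSpan? bs x) x∈ in
        does⁺ (inSpan? bs (c · x)) (c · cs , trans (linComb-· c cs bs) (cong (c ·_) eq))
    }

  ∈-Span⁺ : ∀ {v n} (bs : Vec (Vector v) n) {x} → InSpan bs x → x ∈ˢ Span bs
  ∈-Span⁺ bs {x} = does⁺ (inSpan? bs x)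

  ∈-Span⁻ : ∀ {v n} (bs : Vec (Vector v) n) {x} → x ∈ˢ Span bs → InSpan bs x
  ∈-Span⁻ bs {x} = does⁻ (inSpan? bs x)

  Span-least : ∀ {v n} (bs : Vec (Vector v) n) (X : Subspace v) → VecAll.All (_∈ˢ X) bs → Span bs ⊆ X
  Span-least bs X bs∈ x x∈ = let (cs , eq) = ∈-Span⁻ bs x∈ in subst (_∈ˢ X) eq (linComb-∈ X bs∈ cs)

  linComb-injective : ∀ {v n} {bs : Vec (Vector v) n} → LinearlyIndependent bs →
                      ∀ cs ds → linComb cs bs ≡ linComb ds bs → cs ≡ ds
  linComb-injective {bs = bs} ind cs ds eq = -ᵛ≡0 cs ds (ind _ (begin
    linComb (cs +ᵛ (-ᵛ ds)) bs                ≡⟨ linComb-+ cs (-ᵛ ds) bs ⟩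
    linComb cs bs +ᵛ linComb (-ᵛ ds) bs       ≡⟨ cong₂ _+ᵛ_ eq (linComb-· _ ds bs) ⟩
    linComb ds bs +ᵛ (-ᵛ (linComb ds bs))     ≡⟨ -ᵛ-inverseʳ _ ⟩
    0ᵛ                                        ∎))
    where open ≡-Reasoning

  -- Double counting of pairs of a coefficient tuple and its value: each tuple has one value, and by
  -- independence each vector of the span comes from one tuple.
  size-Span : ∀ {v n} (bs : Vec (Vector v) n) → LinearlyIndependent bs → size (Span bs) ≡ q ^ n
  size-Span {v} {n} bs ind = begin
    ∑ (vectors v) (λ x → ⟦ x ∈ˢ? Span bs ⟧)                                       ≡⟨ ∑-cong (vectors v) fibre ⟨
    ∑ (vectors v) (λ x → ∑ (vectors n) (λ cs → ⟦ linComb cs bs ≟ᵛ x ⟧))           ≡⟨ ∑-swap (vectors v) (vectors n) _ ⟩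
    ∑ (vectors n) (λ cs → ∑ (vectors v) (λ x → ⟦ linComb cs bs ≟ᵛ x ⟧))           ≡⟨ ∑-cong (vectors n) (λ cs →
                                                                                       vectors-unique (linComb cs bs ≟ᵛ_) (linComb cs bs) (λ _ → sym) refl) ⟩
    ∑ (vectors n) (λ _ → 1)                                                       ≡⟨ ∑-const (vectors n) 1 ⟩
    length (vectors n) * 1                                                        ≡⟨ *-identityʳ _ ⟩
    length (vectors n)                                                            ≡⟨ length-vectors n ⟩
    q ^ n                                                                         ∎
    where
    open ≡-Reasoning
    fibre : ∀ x → ∑ (vectors n) (λ cs → ⟦ linComb cs bs ≟ᵛ x ⟧) ≡ ⟦ x ∈ˢ? Span bs ⟧
    fibre x = cases (inSpan? bs x)
      where
      cases : Dec (InSpan bs x) → ∑ (vectors n) (λ cs → ⟦ linComb cs bs ≟ᵛ x ⟧) ≡ ⟦ x ∈ˢ? Span bs ⟧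
      cases (yes (cs , eq)) = trans
        (vectors-unique (λ ds → linComb ds bs ≟ᵛ x) cs
          (λ ds eq′ → linComb-injective ind ds cs (trans eq′ (sym eq))) eq)
        (sym (⟦⟧-yes (x ∈ˢ? Span bs) (∈-Span⁺ bs (cs , eq))))
      cases (no x∉) = trans
        (∑-cong (vectors n) (λ cs → ⟦⟧-no (linComb cs bs ≟ᵛ x) (λ eq → x∉ (cs , eq))))
        (trans (∑-zero (vectors n)) (sym (⟦⟧-no (x ∈ˢ? Span bs) (x∉ ∘ ∈-Span⁻ bs))))

  -- Frees `dim` from the greedy choice of a basis: dimension becomes a function of cardinality, and
  -- its monotonicity and rigidity follow by counting.
  size-dim : ∀ {v} (X : Subspace v) → size X ≡ q ^ dim X
  size-dim {v} X = trans (≤-antisym (size-mono X (Span basis) (λ x → ∈-Span⁺ basis ∘ spanning x))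
                                    (size-mono (Span basis) X (Span-least basis X contained)))
                         (size-Span basis independent)
    where open Basis (basisOf X)

  q^-cancel-≤ : ∀ {m n} → q ^ m ≤ q ^ n → m ≤ n
  q^-cancel-≤ le = ≮⇒≥ (λ n<m → <⇒≱ (^-monoʳ-< q q≥2 n<m) le)

  q^-injective : ∀ {m n} → q ^ m ≡ q ^ n → m ≡ n
  q^-injective eq = ≤-antisym (q^-cancel-≤ (≤-reflexive eq)) (q^-cancel-≤ (≤-reflexive (sym eq)))

  dim-unique : ∀ {v n} (X : Subspace v) → size X ≡ q ^ n → dim X ≡ n
  dim-unique X eq = q^-injective (trans (sym (size-dim X)) eq)

  dim-mono : ∀ {v} (X Y : Subspace v) → X ⊆ Y → dim X ≤ dim Y
  dim-mono X Y X⊆Y = q^-cancel-≤ (subst₂ _≤_ (size-dim X) (size-dim Y) (size-mono X Y X⊆Y))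

  dim-tight : ∀ {v} (X Y : Subspace v) → X ⊆ Y → dim X ≡ dim Y → X ≈ˢ Y
  dim-tight X Y X⊆Y eq = size-tight X Y X⊆Y (trans (size-dim X) (trans (cong (q ^_) eq) (sym (size-dim Y))))

  dim-< : ∀ {v} (X Y : Subspace v) → X ⊆ Y → ¬ X ≈ˢ Y → dim X < dim Y
  dim-< X Y X⊆Y X≉Y = ≤∧≢⇒< (dim-mono X Y X⊆Y) (λ eq → X≉Y (dim-tight X Y X⊆Y eq))

  dim≤ : ∀ {v} (X : Subspace v) → dim X ≤ v
  dim≤ {v} X = q^-cancel-≤ (begin
    q ^ dim X                     ≡⟨ size-dim X ⟨
    size X                        ≤⟨ ∑-mono (vectors v) (λ x → ⟦⟧-≤1 (x ∈ˢ? X)) ⟩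
    ∑ (vectors v) (λ _ → 1)       ≡⟨ ∑-const (vectors v) 1 ⟩
    length (vectors v) * 1        ≡⟨ *-identityʳ _ ⟩
    length (vectors v)            ≡⟨ length-vectors v ⟩
    q ^ v                         ∎)
    where open ≤-Reasoning

  Zero : ∀ {v} → Subspace v
  Zero = Span []

  dim-Zero : ∀ {v} → dim (Zero {v}) ≡ 0
  dim-Zero {v} = dim-unique (Zero {v}) (size-Span {v} [] (λ { [] _ → refl }))

  Zero-⊆ : ∀ {v} (X : Subspace v) → Zero ⊆ X
  Zero-⊆ X = Span-least [] X VecAll.[]

  ∈-⊓⁺ : ∀ {v} (X Y : Subspace v) x → x ∈ˢ X → x ∈ˢ Y → x ∈ˢ X ⊓ Y
  ∈-⊓⁺ X Y x x∈X x∈Y = does⁺ ((x ∈ˢ? X) ×-dec (x ∈ˢ? Y)) (x∈X , x∈Y)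

  ∈-⊓⁻ : ∀ {v} (X Y : Subspace v) x → x ∈ˢ X ⊓ Y → x ∈ˢ X × x ∈ˢ Y
  ∈-⊓⁻ X Y x = does⁻ ((x ∈ˢ? X) ×-dec (x ∈ˢ? Y))

  ⊓ˢ-⊆ˡ : ∀ {v} (X Y : Subspace v) → X ⊓ Y ⊆ X
  ⊓ˢ-⊆ˡ X Y x = proj₁ ∘ ∈-⊓⁻ X Y x

  ⊓ˢ-⊆ʳ : ∀ {v} (X Y : Subspace v) → X ⊓ Y ⊆ Y
  ⊓ˢ-⊆ʳ X Y x = proj₂ ∘ ∈-⊓⁻ X Y x

  ⊓ˢ-greatest : ∀ {v} (X Y Z : Subspace v) → Z ⊆ X → Z ⊆ Y → Z ⊆ X ⊓ Y
  ⊓ˢ-greatest X Y Z Z⊆X Z⊆Y x x∈ = ∈-⊓⁺ X Y x (Z⊆X x x∈) (Z⊆Y x x∈)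

  ⊔ˢ-⊆ˡ : ∀ {v} (X Y : Subspace v) → X ⊆ X ⊔ Y
  ⊔ˢ-⊆ˡ X Y x x∈ = does⁺ (inSum? X Y x) (x , 0ᵛ , x∈ , IsSubspace.0∈ (proj₂ Y) , +ᵛ-identityʳ x)

  ⊔ˢ-⊆ʳ : ∀ {v} (X Y : Subspace v) → Y ⊆ X ⊔ Y
  ⊔ˢ-⊆ʳ X Y y y∈ = does⁺ (inSum? X Y y) (0ᵛ , y , IsSubspace.0∈ (proj₂ X) , y∈ , +ᵛ-identityˡ y)

  ⊔ˢ-least : ∀ {v} (X Y Z : Subspace v) → X ⊆ Z → Y ⊆ Z → X ⊔ Y ⊆ Z
  ⊔ˢ-least X Y Z X⊆Z Y⊆Z z z∈ = let (x , y , x∈ , y∈ , eq) = does⁻ (inSum? X Y z) z∈ in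
    subst (_∈ˢ Z) eq (IsSubspace.+-closed (proj₂ Z) x y (X⊆Z x x∈) (Y⊆Z y y∈))

  Orthogonal : ∀ {v} → Subspace v → Vector v → Set
  Orthogonal X y = ∀ x → x ∈ˢ X → x ∙ y ≡ F.0#

  orthogonal? : ∀ {v} (X : Subspace v) y → Dec (Orthogonal X y)
  orthogonal? {v} X y = FiniteSetoid.∀? (Vectors v) (≡.resp _) (λ x → (x ∈ˢ? X) →-dec ((x ∙ y) F.≟ F.0#))

  perp : ∀ {v} → Subspace v → Subspace v
  perp {v} X = comprehension {Vectors v} (≡.resp (Orthogonal X)) (orthogonal? X) , record
    { 0∈       = does⁺ (orthogonal? X 0ᵛ) (λ x _ → ∙-zeroʳ x)
    ; +-closed = λ y z y∈ z∈ → does⁺ (orthogonal? X (y +ᵛ z)) λ x x∈ → begin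
        x ∙ (y +ᵛ z)         ≡⟨ ∙-comm x (y +ᵛ z) ⟩
        (y +ᵛ z) ∙ x         ≡⟨ ∙-distribʳ x y z ⟩
        y ∙ x F.+ z ∙ x      ≡⟨ cong₂ F._+_ (∙-comm y x) (∙-comm z x) ⟩
        x ∙ y F.+ x ∙ z      ≡⟨ cong₂ F._+_ (does⁻ (orthogonal? X y) y∈ x x∈) (does⁻ (orthogonal? X z) z∈ x x∈) ⟩
        F.0# F.+ F.0#        ≡⟨ F.+-identityˡ F.0# ⟩
        F.0#                 ∎
    ; ·-closed = λ c y y∈ → does⁺ (orthogonal? X (c · y)) λ x x∈ → begin
        x ∙ (c · y)          ≡⟨ ∙-comm x (c · y) ⟩
        (c · y) ∙ x          ≡⟨ ·-∙ c y x ⟩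
        c F.* (y ∙ x)        ≡⟨ cong (c F.*_) (∙-comm y x) ⟩
        c F.* (x ∙ y)        ≡⟨ cong (c F.*_) (does⁻ (orthogonal? X y) y∈ x x∈) ⟩
        c F.* F.0#           ≡⟨ F.zeroʳ c ⟩
        F.0#                 ∎
    }
    where open ≡-Reasoning

  ∈-perp⁺ : ∀ {v} (X : Subspace v) y → Orthogonal X y → y ∈ˢ perp X
  ∈-perp⁺ X y = does⁺ (orthogonal? X y)

  ∈-perp⁻ : ∀ {v} (X : Subspace v) y → y ∈ˢ perp X → Orthogonal X y
  ∈-perp⁻ X y = does⁻ (orthogonal? X y)

  -- A functional that does not vanish on X takes all q values equally often.
  size-kernel : ∀ {v} (X : Subspace v) (y x₀ : Vector v) → x₀ ∈ˢ X → x₀ ∙ y ≢ F.0# →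
                q * ∑ (vectors v) (λ x → ⟦ x ∈ˢ? X ⟧ * ⟦ (x ∙ y) F.≟ F.0# ⟧) ≡ size X
  size-kernel {v} X y x₀ x₀∈ x₀∙y≢0 = begin
    q * fibre F.0#                                                                    ≡⟨ cong (_* fibre F.0#) length-scalars ⟨
    length F.scalars * fibre F.0#                                                     ≡⟨ ∑-const F.scalars (fibre F.0#) ⟨
    ∑ F.scalars (λ _ → fibre F.0#)                                                    ≡⟨ ∑-cong F.scalars fibre-≡ ⟨
    ∑ F.scalars fibre                                                                 ≡⟨ ∑-swap F.scalars (vectors v) _ ⟩
    ∑ (vectors v) (λ x → ∑ F.scalars (λ a → ⟦ x ∈ˢ? X ⟧ * ⟦ (x ∙ y) F.≟ a ⟧))           ≡⟨ ∑-cong (vectors v) (λ x → trans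
                                                                                           (∑-*ˡ F.scalars _ ⟦ x ∈ˢ? X ⟧)
                                                                                           (trans (cong (⟦ x ∈ˢ? X ⟧ *_) (one x)) (*-identityʳ _))) ⟩
    size X                                                                            ∎
    where
    open ≡-Reasoning
    open IsSubspace (proj₂ X)

    fibre : F.Carrier → ℕ
    fibre a = ∑ (vectors v) (λ x → ⟦ x ∈ˢ? X ⟧ * ⟦ (x ∙ y) F.≟ a ⟧)

    one : ∀ x → ∑ F.scalars (λ a → ⟦ (x ∙ y) F.≟ a ⟧) ≡ 1
    one x = trans (∑-cong F.scalars (λ a → ⟦⟧-cong ((x ∙ y) F.≟ a) (a F.≟ (x ∙ y)) sym sym)) (scalars-δ (x ∙ y))

    inverse = F.invertible (x₀ ∙ y) x₀∙y≢0

    -- A multiple of `x₀` on which the functional takes the value `a`. Translation by it preserves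
    -- `X` and carries the fibre over 0 to the fibre over `a`.
    shift : F.Carrier → Vector v
    shift a = (a F.* proj₁ inverse) · x₀

    shift∈ : ∀ a → shift a ∈ˢ X
    shift∈ a = ·-closed _ x₀ x₀∈

    shift-∙ : ∀ a → shift a ∙ y ≡ a
    shift-∙ a = begin
      shift a ∙ y                              ≡⟨ ·-∙ _ x₀ y ⟩
      (a F.* proj₁ inverse) F.* (x₀ ∙ y)       ≡⟨ F.*-assoc a _ _ ⟩
      a F.* (proj₁ inverse F.* (x₀ ∙ y))       ≡⟨ cong (a F.*_) (proj₂ inverse) ⟩
      a F.* F.1#                               ≡⟨ F.*-identityʳ a ⟩
      a                                        ∎

    fibre-≡ : ∀ a → fibre a ≡ fibre F.0#
    fibre-≡ a = trans (sym (∑-translate (shift a) (λ x → ⟦ x ∈ˢ? X ⟧ * ⟦ (x ∙ y) F.≟ a ⟧)))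
      (∑-cong (vectors v) (λ x → cong₂ _*_
        (⟦⟧-cong (x +ᵛ shift a ∈ˢ? X) (x ∈ˢ? X)
          (λ x+t∈ → subst (_∈ˢ X) (+-ᵛ x (shift a)) (+-closed _ _ x+t∈ (·-closed _ _ (shift∈ a))))
          (λ x∈ → +-closed _ _ x∈ (shift∈ a)))
        (⟦⟧-cong (((x +ᵛ shift a) ∙ y) F.≟ a) ((x ∙ y) F.≟ F.0#)
          (λ eq → cancel (trans (sym (value x)) eq))
          (λ eq → trans (value x) (trans (cong (F._+ a) eq) (F.+-identityˡ a))))))
      where
      value : ∀ x → (x +ᵛ shift a) ∙ y ≡ x ∙ y F.+ a
      value x = trans (∙-distribʳ y x (shift a)) (cong (x ∙ y F.+_) (shift-∙ a))
      cancel : ∀ {b} → b F.+ a ≡ a → b ≡ F.0#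
      cancel {b} eq = begin
        b                        ≡⟨ F.+-identityʳ b ⟨
        b F.+ F.0#               ≡⟨ cong (b F.+_) (F.-‿inverseʳ a) ⟨
        b F.+ (a F.+ F.- a)      ≡⟨ F.+-assoc b a (F.- a) ⟨
        (b F.+ a) F.+ F.- a      ≡⟨ cong (F._+ F.- a) eq ⟩
        a F.+ F.- a              ≡⟨ F.-‿inverseʳ a ⟩
        F.0#                     ∎

-- Orthogonal complements

module Duality {q : ℕ} (F : FiniteField q) where
  open LinearAlgebra F
  private module F = FiniteField F

  Full : ∀ {v} → Subspace v
  Full = record { to = λ _ → true ; resp = λ _ → refl } , record
    { 0∈ = _ ; +-closed = _ ; ·-closed = _ }

  size-Full : ∀ {v} → size (Full {v}) ≡ q ^ v
  size-Full {v} = trans (∑-const (vectors v) 1) (trans (*-identityʳ _) (length-vectors v))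

  private
    r : ℕ
    r = pred q

    r>0 : 0 < r
    r>0 = pred-mono-≤ q≥2

    q* : ∀ m → q * m ≡ m + r * m
    q* m = cong (_* m) (sym (suc-pred q {{>-nonZero (<-trans z<s q≥2)}}))

    orth : ∀ {v} → Subspace v → Vector v → Vector v → ℕ
    orth X x y = ⟦ x ∈ˢ? X ⟧ * ⟦ (x ∙ y) F.≟ F.0# ⟧

    -- A non-zero `x` is orthogonal to a q-th of all vectors; the zero vector is orthogonal to all
    -- of them, an excess of (q - 1) q ^ v after multiplication by q. The factor q avoids the
    -- exponent v - 1.
    row : ∀ {v} (X : Subspace v) x → q * ∑ (vectors v) (orth X x) ≡ ⟦ x ∈ˢ? X ⟧ * q ^ v + ⟦ x ≟ᵛ 0ᵛ ⟧ * (r * q ^ v)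
    row {v} X x = trans (cong (q *_) (∑-*ˡ (vectors v) _ ⟦ x ∈ˢ? X ⟧)) (cases (x ≟ᵛ 0ᵛ))
      where
      open ≡-Reasoning
      kernel = ∑ (vectors v) (λ y → ⟦ (x ∙ y) F.≟ F.0# ⟧)
      kernel-≢ : x ≢ 0ᵛ → q * kernel ≡ q ^ v
      kernel-≢ x≢0 = let (y₀ , x∙y₀≢0) = nondegenerate x x≢0 in begin
        q * kernel                                                          ≡⟨ cong (q *_) (∑-cong (vectors v) (λ y → trans
                                                                                 (⟦⟧-cong ((x ∙ y) F.≟ F.0#) ((y ∙ x) F.≟ F.0#) (trans (∙-comm y x)) (trans (∙-comm x y)))
                                                                                 (sym (*-identityˡ _)))) ⟩
        q * ∑ (vectors v) (λ y → ⟦ y ∈ˢ? Full ⟧ * ⟦ (y ∙ x) F.≟ F.0# ⟧)     ≡⟨ size-kernel Full x y₀ _ (λ eq → x∙y₀≢0 (trans (∙-comm x y₀) eq)) ⟩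
        size (Full {v})                                                     ≡⟨ size-Full {v} ⟩
        q ^ v                                                               ∎
      kernel-0 : x ≡ 0ᵛ → kernel ≡ q ^ v
      kernel-0 refl = trans (∑-cong (vectors v) (λ y → ⟦⟧-yes ((0ᵛ ∙ y) F.≟ F.0#) (trans (∙-comm 0ᵛ y) (∙-zeroʳ y)))) (size-Full {v})
      cases : Dec (x ≡ 0ᵛ) → q * (⟦ x ∈ˢ? X ⟧ * kernel) ≡ ⟦ x ∈ˢ? X ⟧ * q ^ v + ⟦ x ≟ᵛ 0ᵛ ⟧ * (r * q ^ v)
      cases (yes x≡0) = begin
        q * (⟦ x ∈ˢ? X ⟧ * kernel)                  ≡⟨ cong₂ (λ a b → q * (a * b)) x∈ (kernel-0 x≡0) ⟩
        q * (1 * q ^ v)                             ≡⟨ cong (q *_) (*-identityˡ _) ⟩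
        q * q ^ v                                   ≡⟨ q* (q ^ v) ⟩
        q ^ v + r * q ^ v                           ≡⟨ cong₂ _+_ (*-identityˡ (q ^ v)) (*-identityˡ _) ⟨
        1 * q ^ v + 1 * (r * q ^ v)                 ≡⟨ cong₂ (λ a b → a * q ^ v + b * (r * q ^ v)) x∈ (⟦⟧-yes (x ≟ᵛ 0ᵛ) x≡0) ⟨
        ⟦ x ∈ˢ? X ⟧ * q ^ v + ⟦ x ≟ᵛ 0ᵛ ⟧ * (r * q ^ v)  ∎
        where
        x∈ = ⟦⟧-yes (x ∈ˢ? X) (subst (_∈ˢ X) (sym x≡0) (IsSubspace.0∈ (proj₂ X)))
      cases (no x≢0) = begin
        q * (⟦ x ∈ˢ? X ⟧ * kernel)                  ≡⟨ lemma q ⟦ x ∈ˢ? X ⟧ kernel ⟩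
        ⟦ x ∈ˢ? X ⟧ * (q * kernel)                  ≡⟨ cong (⟦ x ∈ˢ? X ⟧ *_) (kernel-≢ x≢0) ⟩
        ⟦ x ∈ˢ? X ⟧ * q ^ v                         ≡⟨ +-identityʳ _ ⟨
        ⟦ x ∈ˢ? X ⟧ * q ^ v + 0                     ≡⟨ cong (λ a → ⟦ x ∈ˢ? X ⟧ * q ^ v + a * (r * q ^ v)) (⟦⟧-no (x ≟ᵛ 0ᵛ) x≢0) ⟨
        ⟦ x ∈ˢ? X ⟧ * q ^ v + ⟦ x ≟ᵛ 0ᵛ ⟧ * (r * q ^ v)  ∎
        where
        lemma : ∀ a b c → a * (b * c) ≡ b * (a * c)
        lemma = solve-∀

    -- Either some vector of `X` pairs non-trivially with `y` and the kernel is a q-th of `X`, or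
    -- `y` lies in the complement and the kernel is all of `X`, an excess of (q - 1) |X|.
    column : ∀ {v} (X : Subspace v) y → q * ∑ (vectors v) (λ x → orth X x y) ≡ size X + ⟦ y ∈ˢ? perp X ⟧ * (r * size X)
    column {v} X y = cases (FiniteSetoid.∃? (Vectors v) (≡.resp _) (λ x → (x ∈ˢ? X) ×-dec ¬? ((x ∙ y) F.≟ F.0#)))
      where
      open ≡-Reasoning
      cases : Dec (∃ λ x → x ∈ˢ X × x ∙ y ≢ F.0#) → q * ∑ (vectors v) (λ x → orth X x y) ≡ size X + ⟦ y ∈ˢ? perp X ⟧ * (r * size X)
      cases (yes (x₀ , x₀∈ , x₀∙y≢0)) = begin
        q * ∑ (vectors v) (λ x → orth X x y)         ≡⟨ size-kernel X y x₀ x₀∈ x₀∙y≢0 ⟩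
        size X                                       ≡⟨ +-identityʳ _ ⟨
        size X + 0                                   ≡⟨ cong (λ a → size X + a * (r * size X))
                                                          (⟦⟧-no (y ∈ˢ? perp X) (λ y∈ → x₀∙y≢0 (∈-perp⁻ X y y∈ x₀ x₀∈))) ⟨
        size X + ⟦ y ∈ˢ? perp X ⟧ * (r * size X)     ∎
      cases (no ¬∃) = begin
        q * ∑ (vectors v) (λ x → orth X x y)         ≡⟨ cong (q *_) (∑-cong (vectors v) (λ x → trans
                                                          (⟦⟧*-cong (x ∈ˢ? X) (λ x∈ → ⟦⟧-yes ((x ∙ y) F.≟ F.0#) (y∈ x x∈))) (*-identityʳ _))) ⟩
        q * size X                                   ≡⟨ q* (size X) ⟩
        size X + r * size X                          ≡⟨ cong (size X +_) (*-identityˡ _) ⟨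
        size X + 1 * (r * size X)                    ≡⟨ cong (λ a → size X + a * (r * size X)) (⟦⟧-yes (y ∈ˢ? perp X) (∈-perp⁺ X y y∈)) ⟨
        size X + ⟦ y ∈ˢ? perp X ⟧ * (r * size X)     ∎
        where
        y∈ : Orthogonal X y
        y∈ x x∈ = decidable-stable ((x ∙ y) F.≟ F.0#) (λ x∙y≢0 → ¬∃ (x , x∈ , x∙y≢0))

  -- Count the pairs x ∈ X, y ∈ F^v with x ∙ y ≡ 0 in both ways.
  size-perp : ∀ {v} (X : Subspace v) → size X * size (perp X) ≡ q ^ v
  -- The two counts share the term `q ^ v * size X`; what remains carries the positive factor q - 1.
  size-perp {v} X = *-cancelˡ-≡ _ _ r {{>-nonZero r>0}} (+-cancelˡ-≡ (q ^ v * size X) _ _ (begin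
    q ^ v * size X + r * (size X * size (perp X))                                  ≡⟨ lemma (q ^ v) (size X) (size (perp X)) r ⟩
    q ^ v * size X + size (perp X) * (r * size X)                                  ≡⟨ cong₂ _+_ (trans (∑-const (vectors v) (size X)) (cong (_* size X) (length-vectors v)))
                                                                                        (∑-*ʳ (vectors v) _ (r * size X)) ⟨
    ∑ (vectors v) (λ _ → size X) + ∑ (vectors v) (λ y → ⟦ y ∈ˢ? perp X ⟧ * (r * size X))  ≡⟨ ∑-+ (vectors v) _ _ ⟨
    ∑ (vectors v) (λ y → size X + ⟦ y ∈ˢ? perp X ⟧ * (r * size X))                 ≡⟨ ∑-cong (vectors v) (column X) ⟨
    ∑ (vectors v) (λ y → q * ∑ (vectors v) (λ x → orth X x y))                     ≡⟨ ∑-*ˡ (vectors v) _ q ⟩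
    q * ∑ (vectors v) (λ y → ∑ (vectors v) (λ x → orth X x y))                     ≡⟨ cong (q *_) (∑-swap (vectors v) (vectors v) (orth X)) ⟨
    q * ∑ (vectors v) (λ x → ∑ (vectors v) (orth X x))                             ≡⟨ ∑-*ˡ (vectors v) _ q ⟨
    ∑ (vectors v) (λ x → q * ∑ (vectors v) (orth X x))                             ≡⟨ ∑-cong (vectors v) (row X) ⟩
    ∑ (vectors v) (λ x → ⟦ x ∈ˢ? X ⟧ * q ^ v + ⟦ x ≟ᵛ 0ᵛ ⟧ * (r * q ^ v))          ≡⟨ ∑-+ (vectors v) _ _ ⟩
    ∑ (vectors v) (λ x → ⟦ x ∈ˢ? X ⟧ * q ^ v) + ∑ (vectors v) (λ x → ⟦ x ≟ᵛ 0ᵛ ⟧ * (r * q ^ v))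
                                                                                   ≡⟨ cong₂ _+_ (∑-*ʳ (vectors v) _ (q ^ v)) (∑-*ʳ (vectors v) _ (r * q ^ v)) ⟩
    size X * q ^ v + ∑ (vectors v) (λ x → ⟦ x ≟ᵛ 0ᵛ ⟧) * (r * q ^ v)               ≡⟨ cong₂ _+_ (*-comm (size X) (q ^ v)) (trans (cong (_* (r * q ^ v)) (vectors-δ {v} 0ᵛ)) (*-identityˡ _)) ⟩
    q ^ v * size X + r * q ^ v                                                     ∎))
    where
    open ≡-Reasoning
    lemma : ∀ Q s p r → Q * s + r * (s * p) ≡ Q * s + p * (r * s)
    lemma = solve-∀

  dim-perp-+ : ∀ {v} (X : Subspace v) → dim X + dim (perp X) ≡ v
  dim-perp-+ {v} X = q^-injective (begin
    q ^ (dim X + dim (perp X))       ≡⟨ ^-distribˡ-+-* q (dim X) (dim (perp X)) ⟩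
    q ^ dim X * q ^ dim (perp X)     ≡⟨ cong₂ _*_ (size-dim X) (size-dim (perp X)) ⟨
    size X * size (perp X)           ≡⟨ size-perp X ⟩
    q ^ v                            ∎)
    where open ≡-Reasoning

  dim-perp : ∀ {v} (X : Subspace v) → dim (perp X) ≡ v ∸ dim X
  dim-perp X = sym (trans (cong (_∸ dim X) (sym (dim-perp-+ X))) (m+n∸m≡n (dim X) (dim (perp X))))

  perp-antitone : ∀ {v} (X Y : Subspace v) → X ⊆ Y → perp Y ⊆ perp X
  perp-antitone X Y X⊆Y z z∈ = ∈-perp⁺ X z (λ x x∈ → ∈-perp⁻ Y z z∈ x (X⊆Y x x∈))

  ⊆-perp-perp : ∀ {v} (X : Subspace v) → X ⊆ perp (perp X)
  ⊆-perp-perp X x x∈ = ∈-perp⁺ (perp X) x (λ y y∈ → trans (∙-comm y x) (∈-perp⁻ X y y∈ x x∈))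

  -- One inclusion is formal, and equality of dimensions upgrades it.
  perp-involutive : ∀ {v} (X : Subspace v) → X ≈ˢ perp (perp X)
  perp-involutive {v} X = dim-tight X (perp (perp X)) (⊆-perp-perp X) (sym (trans (dim-perp (perp X))
    (trans (cong (v ∸_) (dim-perp X)) (m∸[m∸n]≡n (dim≤ X)))))

  perp-perp-⊆ : ∀ {v} (X : Subspace v) → perp (perp X) ⊆ X
  perp-perp-⊆ X = ≈⇒⊆ (perp (perp X)) X (λ x → sym (perp-involutive X x))

  perp-cong : ∀ {v} (X Y : Subspace v) → X ≈ˢ Y → perp X ≈ˢ perp Y
  perp-cong X Y X≈Y = ⊆-antisym (perp X) (perp Y)
    (perp-antitone Y X (≈⇒⊆ Y X (λ x → sym (X≈Y x)))) (perp-antitone X Y (≈⇒⊆ X Y X≈Y))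

  -- Orthogonality is a Galois connection. For the harder inclusion, `X` and `Y` lie in `perp Z`,
  -- hence `X ⊔ Y` does, and `Z` lies in `perp (perp Z)`, which is contained in `perp (X ⊔ Y)`.
  perp-⊔ : ∀ {v} (X Y : Subspace v) → perp (X ⊔ Y) ≈ˢ perp X ⊓ perp Y
  perp-⊔ X Y = ⊆-antisym (perp (X ⊔ Y)) (perp X ⊓ perp Y)
    (⊓ˢ-greatest (perp X) (perp Y) (perp (X ⊔ Y)) (perp-antitone X (X ⊔ Y) (⊔ˢ-⊆ˡ X Y)) (perp-antitone Y (X ⊔ Y) (⊔ˢ-⊆ʳ X Y)))
    (λ z z∈ → perp-antitone (X ⊔ Y) (perp Z)
      (⊔ˢ-least X Y (perp Z)
        (λ x x∈ → perp-antitone Z (perp X) (⊓ˢ-⊆ˡ (perp X) (perp Y)) x (⊆-perp-perp X x x∈))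
        (λ y y∈ → perp-antitone Z (perp Y) (⊓ˢ-⊆ʳ (perp X) (perp Y)) y (⊆-perp-perp Y y y∈)))
      z (⊆-perp-perp Z z z∈))
    where Z = perp X ⊓ perp Y

  -- In contrast to `perp-⊔` this is not formal: it rests on `perp-perp-⊆`, and so on the dimension
  -- count.
  perp-⊓ : ∀ {v} (X Y : Subspace v) → perp (X ⊓ Y) ≈ˢ perp X ⊔ perp Y
  perp-⊓ X Y = ⊆-antisym (perp (X ⊓ Y)) (perp X ⊔ perp Y)
    (λ z z∈ → perp-perp-⊆ Z z (perp-antitone (perp Z) (X ⊓ Y)
      (⊓ˢ-greatest X Y (perp Z)
        (λ x x∈ → perp-perp-⊆ X x (perp-antitone (perp X) Z (⊔ˢ-⊆ˡ (perp X) (perp Y)) x x∈))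
        (λ y y∈ → perp-perp-⊆ Y y (perp-antitone (perp Y) Z (⊔ˢ-⊆ʳ (perp X) (perp Y)) y y∈)))
      z z∈))
    (⊔ˢ-least (perp X) (perp Y) (perp (X ⊓ Y)) (perp-antitone (X ⊓ Y) X (⊓ˢ-⊆ˡ X Y)) (perp-antitone (X ⊓ Y) Y (⊓ˢ-⊆ʳ X Y)))
    where Z = perp X ⊔ perp Y

  dₛ-perp : ∀ {v} (X Y : Subspace v) → dₛ (perp X) (perp Y) ≡ dₛ X Y
  dₛ-perp {v} X Y = begin
    dim (perp X ⊔ perp Y) ∸ dim (perp X ⊓ perp Y)     ≡⟨ cong₂ _∸_ (dim-cong {X = perp (X ⊓ Y)} {perp X ⊔ perp Y} (perp-⊓ X Y))
                                                                   (dim-cong {X = perp (X ⊔ Y)} {perp X ⊓ perp Y} (perp-⊔ X Y)) ⟨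
    dim (perp (X ⊓ Y)) ∸ dim (perp (X ⊔ Y))           ≡⟨ cong₂ _∸_ (dim-perp (X ⊓ Y)) (dim-perp (X ⊔ Y)) ⟩
    (v ∸ dim (X ⊓ Y)) ∸ (v ∸ dim (X ⊔ Y))             ≡⟨ [m∸n]∸[m∸o]≡o∸n v (dim (X ⊓ Y)) (dim≤ (X ⊔ Y)) ⟩
    dim (X ⊔ Y) ∸ dim (X ⊓ Y)                         ∎
    where
    open ≡-Reasoning
    [m∸n]∸[m∸o]≡o∸n : ∀ m n {o} → o ≤ m → (m ∸ n) ∸ (m ∸ o) ≡ o ∸ n
    [m∸n]∸[m∸o]≡o∸n m n {o} o≤m = begin
      (m ∸ n) ∸ (m ∸ o)      ≡⟨ ∸-+-assoc m n (m ∸ o) ⟩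
      m ∸ (n + (m ∸ o))      ≡⟨ cong (m ∸_) (+-comm n (m ∸ o)) ⟩
      m ∸ ((m ∸ o) + n)      ≡⟨ ∸-+-assoc m (m ∸ o) n ⟨
      m ∸ (m ∸ o) ∸ n        ≡⟨ cong (_∸ n) (m∸[m∸n]≡n o≤m) ⟩
      o ∸ n                  ∎

-- Covering pairs

module Cover {q : ℕ} (F : FiniteField q) (v : ℕ) where
  open LinearAlgebra F
  open Duality F
  open Finite (Subspaces v)
  private S = Subspaces v

  infix 4 _⋖_ _⋖?_

  _⋖_ : Subspace v → Subspace v → Set
  X ⋖ Y = X ⊆ Y × dim Y ≡ suc (dim X)

  _⋖?_ : ∀ X Y → Dec (X ⋖ Y)
  X ⋖? Y = (X ⊆? Y) ×-dec (dim Y ℕ.≟ suc (dim X))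

  ⋖-perp : ∀ X Y → X ⋖ Y → perp Y ⋖ perp X
  ⋖-perp X Y (X⊆Y , eq) = perp-antitone X Y X⊆Y , (begin
    dim (perp X)           ≡⟨ dim-perp X ⟩
    v ∸ dim X              ≡⟨ +-∸-assoc 1 (subst (_≤ v) eq (dim≤ Y)) ⟩
    suc (v ∸ suc (dim X))  ≡⟨ cong (λ d → suc (v ∸ d)) eq ⟨
    suc (v ∸ dim Y)        ≡⟨ cong suc (dim-perp Y) ⟨
    suc (dim (perp Y))     ∎)
    where open ≡-Reasoning

  ⋖-respˡ : ∀ X X′ Y → X ≈ˢ X′ → X ⋖ Y → X′ ⋖ Y
  ⋖-respˡ X X′ Y X≈ (X⊆Y , eq) = (λ x x∈ → X⊆Y x (≈⇒⊆ X′ X (λ z → sym (X≈ z)) x x∈))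
    , trans eq (cong suc (dim-cong {X = X} {X′} X≈))

  ⋖-respʳ : ∀ X Y Y′ → Y ≈ˢ Y′ → X ⋖ Y → X ⋖ Y′
  ⋖-respʳ X Y Y′ Y≈ (X⊆Y , eq) = (λ x x∈ → ≈⇒⊆ Y Y′ Y≈ x (X⊆Y x x∈))
    , trans (sym (dim-cong {X = Y} {Y′} Y≈)) eq

  -- Complementation permutes the classes but not the chosen representatives, so the two sums are
  -- matched up to `≈ˢ`.
  ∑-perp : (f : Subspace v → ℕ) → (∀ X Y → X ≈ˢ Y → f X ≡ f Y) →
           ∑ reps (λ X → f (perp X)) ≡ ∑ reps f
  ∑-perp f f-resp = ∑-matching reps reps (λ X Y → FiniteSetoid._≟_ S Y (perp X))
    (λ X → reps-δ (perp X))
    (λ Y → reps-unique (λ X → FiniteSetoid._≟_ S Y (perp X)) (perp Y)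
      (λ X Y≈ x → trans (perp-involutive X x) (perp-cong (perp X) Y (λ z → sym (Y≈ z)) x))
      (λ X X≈ x → trans (perp-involutive Y x) (perp-cong (perp Y) X (λ z → sym (X≈ z)) x)))
    (λ X Y Y≈ → f-resp (perp X) Y (λ x → sym (Y≈ x)))

  -- Every vector outside X lies in exactly one cover of X, and every cover
  -- contains q ^ (dim X + 1) - q ^ dim X of them; this determines the degree.
  module _ (X : Subspace v) where
    private
      open Basis (basisOf X) hiding (size)

      adjoin : Vector v → Subspace v
      adjoin z = Span (z ∷ basis)

      X⊆adjoin : ∀ z → X ⊆ adjoin z
      X⊆adjoin z x x∈ = ∈-Span⁺ (z ∷ basis) (InSpan-∷ z (spanning x x∈))

      z∈adjoin : ∀ z → z ∈ˢ adjoin z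
      z∈adjoin z = ∈-Span⁺ (z ∷ basis) (InSpan-head basis z)

      dim-adjoin : ∀ z → ¬ z ∈ˢ X → dim (adjoin z) ≡ suc (dim X)
      dim-adjoin z z∉ = dim-unique (adjoin z) (size-Span (z ∷ basis)
        (independent-∷ independent (λ z∈ → z∉ (Span-least basis X contained z (∈-Span⁺ basis z∈)))))

      -- A cover of `X` through `z` contains `adjoin z` and has the same dimension, hence equals it.
      covers-through : ∀ z → ¬ z ∈ˢ X → ∑ reps (λ Y → ⟦ X ⋖? Y ⟧ * ⟦ z ∈ˢ? Y ⟧) ≡ 1
      covers-through z z∉ = trans (∑-cong reps (λ Y → sym (⟦⟧-× (X ⋖? Y) (z ∈ˢ? Y))))
        (reps-unique (λ Y → (X ⋖? Y) ×-dec (z ∈ˢ? Y)) (adjoin z)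
          (λ { Y ((X⊆Y , dimY) , z∈Y) x → sym (dim-tight (adjoin z) Y
                (Span-least (z ∷ basis) Y (z∈Y VecAll.∷ VecAll.map (λ {b} b∈ → X⊆Y b b∈) contained))
                (trans (dim-adjoin z z∉) (sym dimY)) x) })
          (λ Y Y≈ → ⋖-respʳ X (adjoin z) Y (λ x → sym (Y≈ x)) (X⊆adjoin z , dim-adjoin z z∉)
                  , ≈⇒⊆ (adjoin z) Y (λ x → sym (Y≈ x)) z (z∈adjoin z)))

      degree = ∑ reps (λ Y → ⟦ X ⋖? Y ⟧)

      through : ∀ z → ∑ reps (λ Y → ⟦ X ⋖? Y ⟧ * ⟦ z ∈ˢ? Y ⟧) ≡ ⟦ z ∈ˢ? X ⟧ * degree + ⟦ ¬? (z ∈ˢ? X) ⟧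
      through z = cases (z ∈ˢ? X)
        where
        cases : (z∈? : Dec (z ∈ˢ X)) → ∑ reps (λ Y → ⟦ X ⋖? Y ⟧ * ⟦ z ∈ˢ? Y ⟧) ≡ ⟦ z∈? ⟧ * degree + ⟦ ¬? z∈? ⟧
        cases (yes z∈) = trans
          (∑-cong reps (λ Y → trans (⟦⟧*-cong (X ⋖? Y) (λ X⋖Y → ⟦⟧-yes (z ∈ˢ? Y) (proj₁ X⋖Y z z∈))) (*-identityʳ _)))
          (sym (trans (+-identityʳ _) (*-identityˡ degree)))
        cases (no z∉) = covers-through z z∉

      -- Pairs of a cover and a vector in it, counted by covers on the left and by vectors on the
      -- right: a vector of `X` lies in all covers, any other in just one.
      incidences : degree * q ^ suc (dim X) ≡ q ^ dim X * degree + ∑ (vectors v) (λ z → ⟦ ¬? (z ∈ˢ? X) ⟧)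
      incidences = begin
        degree * q ^ suc (dim X)                                                   ≡⟨ ∑-*ʳ reps _ _ ⟨
        ∑ reps (λ Y → ⟦ X ⋖? Y ⟧ * q ^ suc (dim X))                                ≡⟨ ∑-cong reps (λ Y → ⟦⟧*-cong (X ⋖? Y) (λ X⋖Y → trans (size-dim Y) (cong (q ^_) (proj₂ X⋖Y)))) ⟨
        ∑ reps (λ Y → ⟦ X ⋖? Y ⟧ * size Y)                                         ≡⟨ ∑-cong reps (λ Y → ∑-*ˡ (vectors v) _ ⟦ X ⋖? Y ⟧) ⟨
        ∑ reps (λ Y → ∑ (vectors v) (λ z → ⟦ X ⋖? Y ⟧ * ⟦ z ∈ˢ? Y ⟧))              ≡⟨ ∑-swap reps (vectors v) _ ⟩
        ∑ (vectors v) (λ z → ∑ reps (λ Y → ⟦ X ⋖? Y ⟧ * ⟦ z ∈ˢ? Y ⟧))              ≡⟨ ∑-cong (vectors v) through ⟩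
        ∑ (vectors v) (λ z → ⟦ z ∈ˢ? X ⟧ * degree + ⟦ ¬? (z ∈ˢ? X) ⟧)              ≡⟨ ∑-+ (vectors v) _ _ ⟩
        ∑ (vectors v) (λ z → ⟦ z ∈ˢ? X ⟧ * degree) + outside                       ≡⟨ cong (_+ outside) (trans (∑-*ʳ (vectors v) _ degree) (cong (_* degree) (size-dim X))) ⟩
        q ^ dim X * degree + outside                                               ∎
        where
        open ≡-Reasoning
        outside = ∑ (vectors v) (λ z → ⟦ ¬? (z ∈ˢ? X) ⟧)

      outside-+ : q ^ dim X + ∑ (vectors v) (λ z → ⟦ ¬? (z ∈ˢ? X) ⟧) ≡ q ^ v
      outside-+ = trans (cong (_+ ∑ (vectors v) (λ z → ⟦ ¬? (z ∈ˢ? X) ⟧)) (sym (size-dim X))) (trans (sym (∑-+ (vectors v) _ _))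
        (trans (∑-cong (vectors v) (λ z → ⟦⟧-¬ (z ∈ˢ? X))) (size-Full {v})))

      -- The geometric sum (q - 1) [n] = q ^ n - 1 without subtraction. `degree-q` has the same
      -- form, so that `determined` can compare the two.
      number-q : ∀ n → number q n * q + 1 ≡ number q n + q ^ n
      number-q zero    = refl
      number-q (suc n) = trans (lemma₁ q (number q n)) (trans (cong (λ z → q * z + 1) (number-q n)) (lemma₂ q (number q n) (q ^ n)))
        where
        lemma₁ : ∀ q g → suc (q * g) * q + 1 ≡ q * (g * q + 1) + 1
        lemma₁ = solve-∀
        lemma₂ : ∀ q g p → q * (g + p) + 1 ≡ suc (q * g) + q * p
        lemma₂ = solve-∀

      degree-q : degree * q + 1 ≡ degree + q ^ (v ∸ dim X)
      degree-q = *-cancelˡ-≡ _ _ (q ^ dim X) {{m^n≢0 q (dim X) {{>-nonZero (<-trans z<s q≥2)}}}} (begin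
        Q * (degree * q + 1)                            ≡⟨ lemma₁ Q degree q ⟩
        degree * q ^ suc (dim X) + Q                    ≡⟨ cong (_+ Q) incidences ⟩
        Q * degree + outside + Q                        ≡⟨ lemma₂ (Q * degree) outside Q ⟩
        Q * degree + (Q + outside)                      ≡⟨ cong (Q * degree +_) outside-+ ⟩
        Q * degree + q ^ v                              ≡⟨ cong (λ n → Q * degree + q ^ n) (m+[n∸m]≡n (dim≤ X)) ⟨
        Q * degree + q ^ (dim X + (v ∸ dim X))          ≡⟨ cong (Q * degree +_) (^-distribˡ-+-* q (dim X) (v ∸ dim X)) ⟩
        Q * degree + Q * q ^ (v ∸ dim X)                ≡⟨ *-distribˡ-+ Q degree _ ⟨
        Q * (degree + q ^ (v ∸ dim X))                  ∎)
        where
        open ≡-Reasoning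
        Q = q ^ dim X
        outside = ∑ (vectors v) (λ z → ⟦ ¬? (z ∈ˢ? X) ⟧)
        lemma₁ : ∀ Q d q → Q * (d * q + 1) ≡ d * (q * Q) + Q
        lemma₁ = solve-∀
        lemma₂ : ∀ a b c → a + b + c ≡ a + (c + b)
        lemma₂ = solve-∀

      determined : ∀ {x y p} → x * q + 1 ≡ x + p → y * q + 1 ≡ y + p → x ≡ y
      determined {x} {y} {p} eq eq′ = *-cancelʳ-≡ _ _ (pred q) {{>-nonZero (pred-mono-≤ q≥2)}}
        (+-cancelʳ-≡ 1 _ _ (trans (reduce x eq) (sym (reduce y eq′))))
        where
        reduce : ∀ z → z * q + 1 ≡ z + p → z * pred q + 1 ≡ p
        reduce z e = +-cancelˡ-≡ z _ _ (trans (trans (sym (+-assoc z _ 1)) (cong (_+ 1) (trans (sym (*-suc z (pred q)))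
          (cong (z *_) (suc-pred q {{>-nonZero (<-trans z<s q≥2)}}))))) e)

    up-degree : ∑ reps (λ Y → ⟦ X ⋖? Y ⟧) ≡ number q (v ∸ dim X)
    up-degree = determined degree-q (number-q (v ∸ dim X))

  -- Complementation turns the subspaces covered by `Y` into the covers of `perp Y`, which
  -- `up-degree` counts.
  down-degree : ∀ Y → ∑ reps (λ X → ⟦ X ⋖? Y ⟧) ≡ number q (dim Y)
  down-degree Y = begin
    ∑ reps (λ X → ⟦ X ⋖? Y ⟧)              ≡⟨ ∑-cong reps (λ X → ⟦⟧-cong (X ⋖? Y) (perp Y ⋖? perp X) (⋖-perp X Y) (back X)) ⟩
    ∑ reps (λ X → ⟦ perp Y ⋖? perp X ⟧)    ≡⟨ ∑-perp (λ X → ⟦ perp Y ⋖? X ⟧) (λ X X′ X≈ → ⟦⟧-cong (perp Y ⋖? X) (perp Y ⋖? X′)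
                                                (⋖-respʳ (perp Y) X X′ X≈) (⋖-respʳ (perp Y) X′ X (λ x → sym (X≈ x)))) ⟩
    ∑ reps (λ X → ⟦ perp Y ⋖? X ⟧)         ≡⟨ up-degree (perp Y) ⟩
    number q (v ∸ dim (perp Y))            ≡⟨ cong (λ d → number q (v ∸ d)) (dim-perp Y) ⟩
    number q (v ∸ (v ∸ dim Y))             ≡⟨ cong (number q) (m∸[m∸n]≡n (dim≤ Y)) ⟩
    number q (dim Y)                       ∎
    where
    open ≡-Reasoning
    back : ∀ X → perp Y ⋖ perp X → X ⋖ Y
    back X p = ⋖-respˡ (perp (perp X)) X Y (λ x → sym (perp-involutive X x))
      (⋖-respʳ (perp (perp X)) (perp (perp Y)) Y (λ x → sym (perp-involutive Y x)) (⋖-perp (perp Y) (perp X) p))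

-- Codes

∑<-upTo : ∀ n f → ∑ (upTo n) f ≡ ∑< n f
∑<-upTo zero    f = refl
∑<-upTo (suc n) f = begin
  ∑ (upTo (suc n)) f                   ≡⟨ cong (λ xs → ∑ xs f) (upTo-∷ʳ n) ⟨
  sum (map f (upTo n ∷ʳ n))            ≡⟨ cong sum (map-++ f (upTo n) (n ∷ [])) ⟩
  sum (map f (upTo n) ++ (f n ∷ []))   ≡⟨ sum-++ (map f (upTo n)) (f n ∷ []) ⟩
  ∑ (upTo n) f + (f n + 0)             ≡⟨ cong₂ _+_ (∑<-upTo n f) (+-identityʳ (f n)) ⟩
  ∑< n f + f n                         ∎
  where open ≡-Reasoning

∑<-∑ : {A : Set} (xs : List A) (f : ℕ → A → ℕ) → ∀ n → ∑< n (λ i → ∑ xs (f i)) ≡ ∑ xs (λ x → ∑< n (λ i → f i x))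
∑<-∑ xs f zero    = sym (∑-zero xs)
∑<-∑ xs f (suc n) = trans (cong (_+ ∑ xs (f n)) (∑<-∑ xs f n)) (sym (∑-+ xs _ (f n)))

∑<-δ : ∀ m {d} n → d < n → ∑< n (λ i → m * ⟦ d ℕ.≟ i ⟧) ≡ m
∑<-δ m {d} (suc n) d<1+n with m≤n⇒m<n∨m≡n (s≤s⁻¹ d<1+n)
... | inj₁ d<n  = trans (cong₂ _+_ (∑<-δ m n d<n) (trans (cong (m *_) (⟦⟧-no (d ℕ.≟ n) (<⇒≢ d<n))) (*-zeroʳ m))) (+-identityʳ m)
... | inj₂ refl = cong₂ _+_ (below d ≤-refl) (trans (cong (m *_) (⟦⟧-yes (d ℕ.≟ d) refl)) (*-identityʳ m))
  where
  below : ∀ n → n ≤ d → ∑< n (λ i → m * ⟦ d ℕ.≟ i ⟧) ≡ 0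
  below zero    n≤d = refl
  below (suc n) n<d = cong₂ _+_ (below n (<⇒≤ n<d)) (trans (cong (m *_) (⟦⟧-no (d ℕ.≟ n) (>⇒≢ n<d))) (*-zeroʳ m))

module Levels {q : ℕ} (F : FiniteField q) (v : ℕ) where
  open LinearAlgebra F
  open Duality F
  open Cover F v
  open Finite (Subspaces v)
  private
    S = Subspaces v

  infix 4 _∈ᶜ?_
  _∈ᶜ?_ : (X : Subspace v) (C : Code v) → Dec (_∈_ {S} X C)
  X ∈ᶜ? C = _∈?_ {S} X C

  level : Code v → ℕ → ℕ
  level C i = ∑ reps (λ X → ⟦ X ∈ᶜ? C ⟧ * ⟦ dim X ℕ.≟ i ⟧)

  ∣∣-levels : ∀ C → ∣ C ∣ ≡ ∑< (suc v) (level C)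
  ∣∣-levels C = trans (∣∣-∑ C) (sym (trans (∑<-∑ reps _ (suc v))
    (∑-cong reps (λ X → ∑<-δ ⟦ X ∈ᶜ? C ⟧ (suc v) (s≤s (dim≤ X))))))

  gaussian-∑ : ∀ i → gaussian v i ≡ ∑ reps (λ X → ⟦ dim X ℕ.≟ i ⟧)
  gaussian-∑ i = ∣∣-∑ (byDim (ℕ._≟ i))

  level-parityCode : ∀ k i → level (parityCode v k) i ≡ target (gaussian v) k i
  level-parityCode k i = begin
    ∑ reps (λ X → ⟦ dim X % 2 ℕ.≟ k % 2 ⟧ * ⟦ dim X ℕ.≟ i ⟧)   ≡⟨ ∑-cong reps (λ X → trans (*-comm ⟦ dim X % 2 ℕ.≟ k % 2 ⟧ _)
                                                                     (trans (⟦⟧*-cong (dim X ℕ.≟ i) (λ eq → cong (same k) eq)) (*-comm ⟦ dim X ℕ.≟ i ⟧ _))) ⟩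
    ∑ reps (λ X → same k i * ⟦ dim X ℕ.≟ i ⟧)                  ≡⟨ ∑-*ˡ reps _ (same k i) ⟩
    same k i * ∑ reps (λ X → ⟦ dim X ℕ.≟ i ⟧)                  ≡⟨ cong (same k i *_) (gaussian-∑ i) ⟨
    same k i * gaussian v i                                    ∎
    where open ≡-Reasoning

  gaussianSum-∑ : ∀ k → gaussianSum v k ≡ ∑< (suc v) (target (gaussian v) k)
  gaussianSum-∑ k = trans (∑-filter (≡?-mod2 k) (gaussian v) (upTo (suc v))) (∑<-upTo (suc v) _)

  ∣parityCode∣ : ∀ k → ∣ parityCode v k ∣ ≡ gaussianSum v k
  ∣parityCode∣ k = trans (∣∣-levels (parityCode v k))
    (trans (∑<-cong (suc v) (λ i _ → level-parityCode k i)) (sym (gaussianSum-∑ k)))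

  private
    -- Covering pairs weighted at their lower end: each `X` of dimension `i` occurs once per cover.
    -- `down-sum` is the counterpart for the upper end, and `level-shift` passes between the two.
    up-sum : ∀ (f : Subspace v → ℕ) i →
             ∑ reps (λ X → ∑ reps (λ Y → ⟦ X ⋖? Y ⟧ * (f X * ⟦ dim X ℕ.≟ i ⟧)))
             ≡ ∑ reps (λ X → f X * ⟦ dim X ℕ.≟ i ⟧) * number q (v ∸ i)
    up-sum f i = trans (∑-cong reps (λ X → trans (∑-*ʳ reps _ (f X * ⟦ dim X ℕ.≟ i ⟧))
        (trans (cong (_* (f X * ⟦ dim X ℕ.≟ i ⟧)) (up-degree X)) (at X))))
      (∑-*ʳ reps _ (number q (v ∸ i)))
      where
      at : ∀ X → number q (v ∸ dim X) * (f X * ⟦ dim X ℕ.≟ i ⟧) ≡ f X * ⟦ dim X ℕ.≟ i ⟧ * number q (v ∸ i)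
      at X = trans (lemma (number q (v ∸ dim X)) (f X) ⟦ dim X ℕ.≟ i ⟧)
        (trans (cong (f X *_) (⟦⟧*-cong (dim X ℕ.≟ i) (λ eq → cong (λ d → number q (v ∸ d)) eq))) (sym (*-assoc (f X) _ _)))
        where
        lemma : ∀ a b c → a * (b * c) ≡ b * (c * a)
        lemma = solve-∀

    down-sum : ∀ (f : Subspace v → ℕ) i →
               ∑ reps (λ X → ∑ reps (λ Y → ⟦ X ⋖? Y ⟧ * (f Y * ⟦ dim Y ℕ.≟ i ⟧)))
               ≡ ∑ reps (λ Y → f Y * ⟦ dim Y ℕ.≟ i ⟧) * number q i
    down-sum f i = trans (∑-swap reps reps _) (trans (∑-cong reps (λ Y → trans (∑-*ʳ reps _ (f Y * ⟦ dim Y ℕ.≟ i ⟧))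
        (trans (cong (_* (f Y * ⟦ dim Y ℕ.≟ i ⟧)) (down-degree Y)) (at Y))))
      (∑-*ʳ reps _ (number q i)))
      where
      at : ∀ Y → number q (dim Y) * (f Y * ⟦ dim Y ℕ.≟ i ⟧) ≡ f Y * ⟦ dim Y ℕ.≟ i ⟧ * number q i
      at Y = trans (lemma (number q (dim Y)) (f Y) ⟦ dim Y ℕ.≟ i ⟧)
        (trans (cong (f Y *_) (⟦⟧*-cong (dim Y ℕ.≟ i) (λ eq → cong (number q) eq))) (sym (*-assoc (f Y) _ _)))
        where
        lemma : ∀ a b c → a * (b * c) ≡ b * (c * a)
        lemma = solve-∀

    level-shift : ∀ X Y i → X ⋖ Y → ⟦ dim Y ℕ.≟ suc i ⟧ ≡ ⟦ dim X ℕ.≟ i ⟧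
    level-shift X Y i (_ , dimY) = ⟦⟧-cong (dim Y ℕ.≟ suc i) (dim X ℕ.≟ i)
      (λ eq → suc-injective (trans (sym dimY) eq)) (λ eq → trans dimY (cong suc eq))

    all-level : ∀ i → ∑ reps (λ X → 1 * ⟦ dim X ℕ.≟ i ⟧) ≡ gaussian v i
    all-level i = trans (∑-cong reps (λ X → *-identityˡ _)) (sym (gaussian-∑ i))

    gaussian-regular : ∀ i → gaussian v i * number q (v ∸ i) ≡ gaussian v (suc i) * number q (suc i)
    gaussian-regular i = begin
      gaussian v i * number q (v ∸ i)                                                   ≡⟨ cong (_* number q (v ∸ i)) (all-level i) ⟨
      ∑ reps (λ X → 1 * ⟦ dim X ℕ.≟ i ⟧) * number q (v ∸ i)                             ≡⟨ up-sum (λ _ → 1) i ⟨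
      ∑ reps (λ X → ∑ reps (λ Y → ⟦ X ⋖? Y ⟧ * (1 * ⟦ dim X ℕ.≟ i ⟧)))                  ≡⟨ ∑-cong reps (λ X → ∑-cong reps (λ Y →
                                                                                             ⟦⟧*-cong (X ⋖? Y) (λ X⋖Y → cong (1 *_) (level-shift X Y i X⋖Y)))) ⟨
      ∑ reps (λ X → ∑ reps (λ Y → ⟦ X ⋖? Y ⟧ * (1 * ⟦ dim Y ℕ.≟ suc i ⟧)))              ≡⟨ down-sum (λ _ → 1) (suc i) ⟩
      ∑ reps (λ Y → 1 * ⟦ dim Y ℕ.≟ suc i ⟧) * number q (suc i)                         ≡⟨ cong (_* number q (suc i)) (all-level (suc i)) ⟩
      gaussian v (suc i) * number q (suc i)                                             ∎
      where open ≡-Reasoning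

    gaussian-0 : gaussian v 0 ≡ 1
    gaussian-0 = trans (gaussian-∑ 0) (reps-unique (λ X → dim X ℕ.≟ 0) Zero
      (λ X dim≡0 x → sym (dim-tight Zero X (Zero-⊆ X) (trans (dim-Zero {v}) (sym dim≡0)) x))
      (λ X X≈ → trans (dim-cong {X = X} {Zero} X≈) (dim-Zero {v})))

    gaussian-palindromic : ∀ i → i ≤ v → gaussian v (v ∸ i) ≡ gaussian v i
    gaussian-palindromic i i≤v = begin
      gaussian v (v ∸ i)                             ≡⟨ gaussian-∑ (v ∸ i) ⟩
      ∑ reps (λ X → ⟦ dim X ℕ.≟ v ∸ i ⟧)             ≡⟨ ∑-cong reps (λ X → ⟦⟧-cong (dim X ℕ.≟ v ∸ i) (dim (perp X) ℕ.≟ i)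
                                                          (λ eq → trans (dim-perp X) (trans (cong (v ∸_) eq) (m∸[m∸n]≡n i≤v)))
                                                          (λ eq → trans (sym (m∸[m∸n]≡n (dim≤ X))) (cong (v ∸_) (trans (sym (dim-perp X)) eq)))) ⟩
      ∑ reps (λ X → ⟦ dim (perp X) ℕ.≟ i ⟧)          ≡⟨ ∑-perp (λ X → ⟦ dim X ℕ.≟ i ⟧) (λ X Y X≈Y → cong (λ d → ⟦ d ℕ.≟ i ⟧) (dim-cong {X = X} {Y} X≈Y)) ⟩
      ∑ reps (λ X → ⟦ dim X ℕ.≟ i ⟧)                 ≡⟨ gaussian-∑ i ⟨
      gaussian v i                                   ∎
      where open ≡-Reasoning

    dₛ-⋖ : ∀ X Y → X ⋖ Y → dₛ X Y ≡ 1
    dₛ-⋖ X Y (X⊆Y , dimY) = begin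
      dim (X ⊔ Y) ∸ dim (X ⊓ Y)   ≡⟨ cong₂ _∸_ (dim-cong {X = X ⊔ Y} {Y} (⊆-antisym (X ⊔ Y) Y (⊔ˢ-least X Y Y X⊆Y (λ _ z → z)) (⊔ˢ-⊆ʳ X Y)))
                                               (dim-cong {X = X ⊓ Y} {X} (⊆-antisym (X ⊓ Y) X (⊓ˢ-⊆ˡ X Y) (⊓ˢ-greatest X Y X (λ _ z → z) X⊆Y))) ⟩
      dim Y ∸ dim X               ≡⟨ cong (_∸ dim X) dimY ⟩
      suc (dim X) ∸ dim X         ≡⟨ m+n∸n≡m 1 (dim X) ⟩
      1                           ∎
      where open ≡-Reasoning

  module _ (C : Code v) (far : MinDistance≥ 2 C) where

    independent : ∀ X Y → X ⋖ Y → _∈_ {S} X C → _∈_ {S} Y C → ⊥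
    independent X Y X⋖Y X∈ Y∈ = <-irrefl (sym (dₛ-⋖ X Y X⋖Y))
      (far X Y X∈ Y∈ (λ X≈Y → 1+n≢n (trans (sym (proj₂ X⋖Y)) (sym (dim-cong {X = X} {Y} X≈Y)))))

    level-edge : ∀ i → level C i * number q (v ∸ i) + level C (suc i) * number q (suc i) ≤ gaussian v i * number q (v ∸ i)
    level-edge i = begin
      level C i * number q (v ∸ i) + level C (suc i) * number q (suc i)   ≡⟨ cong₂ _+_ (up-sum inC i) (down-sum inC (suc i)) ⟨
      ∑ reps (λ X → ∑ reps (lower X)) + ∑ reps (λ X → ∑ reps (upper X))   ≡⟨ ∑-+ reps _ _ ⟨
      ∑ reps (λ X → ∑ reps (lower X) + ∑ reps (upper X))                  ≡⟨ ∑-cong reps (λ X → ∑-+ reps (lower X) (upper X)) ⟨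
      ∑ reps (λ X → ∑ reps (λ Y → lower X Y + upper X Y))                 ≤⟨ ∑-mono reps (λ X → ∑-mono reps (λ Y → at X Y (X ⋖? Y))) ⟩
      ∑ reps (λ X → ∑ reps (λ Y → ⟦ X ⋖? Y ⟧ * (1 * ⟦ dim X ℕ.≟ i ⟧)))    ≡⟨ up-sum (λ _ → 1) i ⟩
      ∑ reps (λ X → 1 * ⟦ dim X ℕ.≟ i ⟧) * number q (v ∸ i)               ≡⟨ cong (_* number q (v ∸ i)) (all-level i) ⟩
      gaussian v i * number q (v ∸ i)                                     ∎
      where
      open ≤-Reasoning
      inC : Subspace v → ℕ
      inC X = ⟦ X ∈ᶜ? C ⟧
      lower upper : Subspace v → Subspace v → ℕ
      lower X Y = ⟦ X ⋖? Y ⟧ * (inC X * ⟦ dim X ℕ.≟ i ⟧)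
      upper X Y = ⟦ X ⋖? Y ⟧ * (inC Y * ⟦ dim Y ℕ.≟ suc i ⟧)
      one-of : ∀ X Y → X ⋖ Y → (X∈? : Dec (_∈_ {S} X C)) (Y∈? : Dec (_∈_ {S} Y C)) → ⟦ X∈? ⟧ + ⟦ Y∈? ⟧ ≤ 1
      one-of X Y X⋖Y (yes X∈) (yes Y∈) = ⊥-elim (independent X Y X⋖Y X∈ Y∈)
      one-of X Y X⋖Y (yes _)  (no _)   = ≤-refl
      one-of X Y X⋖Y (no _)   Y∈?      = ⟦⟧-≤1 Y∈?
      at : ∀ X Y (X⋖Y? : Dec (X ⋖ Y)) → ⟦ X⋖Y? ⟧ * (inC X * ⟦ dim X ℕ.≟ i ⟧) + ⟦ X⋖Y? ⟧ * (inC Y * ⟦ dim Y ℕ.≟ suc i ⟧)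
           ≤ ⟦ X⋖Y? ⟧ * (1 * ⟦ dim X ℕ.≟ i ⟧)
      at X Y (no _)    = z≤n
      at X Y (yes X⋖Y) = begin
        1 * (inC X * δ) + 1 * (inC Y * ⟦ dim Y ℕ.≟ suc i ⟧)   ≡⟨ cong (λ d → 1 * (inC X * δ) + 1 * (inC Y * d)) (level-shift X Y i X⋖Y) ⟩
        1 * (inC X * δ) + 1 * (inC Y * δ)                     ≡⟨ lemma (inC X) (inC Y) δ ⟩
        1 * ((inC X + inC Y) * δ)                             ≤⟨ *-monoʳ-≤ 1 (*-monoˡ-≤ δ (one-of X Y X⋖Y (X ∈ᶜ? C) (Y ∈ᶜ? C))) ⟩
        1 * (1 * δ)                                           ∎
        where
        δ = ⟦ dim X ℕ.≟ i ⟧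
        lemma : ∀ a b d → 1 * (a * d) + 1 * (b * d) ≡ 1 * ((a + b) * d)
        lemma = solve-∀

    levelCounts : LevelCounts q v (gaussian v) (level C)
    levelCounts = record
      { c≤b         = λ i _ → subst (level C i ≤_) (all-level i) (∑-mono reps (λ X → *-monoˡ-≤ _ (⟦⟧-≤1 (X ∈ᶜ? C))))
      ; b-zero      = gaussian-0
      ; palindromic = gaussian-palindromic
      ; regular     = λ i _ → gaussian-regular i
      ; edge        = λ i _ → level-edge i
      }

  -- Each level of the target is empty or full, so the sum of the indicators of `C` attains a
  -- termwise bound, and `∑-tight` decides every representative individually. A general `X` is first
  -- replaced by its representative.
  levels⇒≈ : ∀ k (C : Code v) → (∀ i → i ≤ v → level C i ≡ target (gaussian v) k i) → C ≈ᶜ parityCode v k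
  levels⇒≈ k C eq X with representative X
  ... | X′ , X′∈ , X≈X′ = trans (Subset.resp C {X} {X′} X≈X′) (trans (at (i % 2 ℕ.≟ k % 2)) (sym (Subset.resp (parityCode v k) {X} {X′} X≈X′)))
    where
    i = dim X′
    P = parityCode v k
    δ : Subspace v → ℕ
    δ Y = ⟦ dim Y ℕ.≟ i ⟧
    δ≡1 : δ X′ ≡ 1
    δ≡1 = ⟦⟧-yes (i ℕ.≟ i) refl
    total : level C i ≡ same k i * gaussian v i
    total = eq i (dim≤ X′)
    at : Dec (i % 2 ≡ k % 2) → C ⟨$⟩ X′ ≡ P ⟨$⟩ X′
    at (yes even) = T-≡ (λ _ → does⁺ (≡?-mod2 k i) even) (λ _ → ⟦⟧-≢0 (X′ ∈ᶜ? C) full)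
      where
      full : ⟦ X′ ∈ᶜ? C ⟧ ≡ 1
      full = begin
        ⟦ X′ ∈ᶜ? C ⟧          ≡⟨ *-identityʳ _ ⟨
        ⟦ X′ ∈ᶜ? C ⟧ * 1      ≡⟨ cong (⟦ X′ ∈ᶜ? C ⟧ *_) δ≡1 ⟨
        ⟦ X′ ∈ᶜ? C ⟧ * δ X′   ≡⟨ ∑-tight reps (λ Y → *-monoˡ-≤ (δ Y) (⟦⟧-≤1 (Y ∈ᶜ? C)))
                                   (trans total (trans (cong (_* gaussian v i) (⟦⟧-yes (i % 2 ℕ.≟ k % 2) even)) (trans (*-identityˡ _) (sym (all-level i))))) X′∈ ⟩
        1 * δ X′              ≡⟨ trans (*-identityˡ _) δ≡1 ⟩
        1                     ∎
        where open ≡-Reasoning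
    at (no odd) = T-≡ (λ X∈ → ⊥-elim (0≢1+n (trans empty (⟦⟧-yes (X′ ∈ᶜ? C) X∈)))) (λ X∈ → ⊥-elim (odd (does⁻ (≡?-mod2 k i) X∈)))
      where
      empty : 0 ≡ ⟦ X′ ∈ᶜ? C ⟧
      empty = begin
        0                     ≡⟨ ∑-tight reps {λ _ → 0} {λ Y → ⟦ Y ∈ᶜ? C ⟧ * δ Y} (λ Y → z≤n)
                                   (trans (∑-zero reps) (sym (trans total (cong (_* gaussian v i) (⟦⟧-no (i % 2 ℕ.≟ k % 2) odd))))) X′∈ ⟩
        ⟦ X′ ∈ᶜ? C ⟧ * δ X′   ≡⟨ cong (⟦ X′ ∈ᶜ? C ⟧ *_) δ≡1 ⟩
        ⟦ X′ ∈ᶜ? C ⟧ * 1      ≡⟨ *-identityʳ _ ⟩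
        ⟦ X′ ∈ᶜ? C ⟧          ∎
        where open ≡-Reasoning

private
  suc%2≡0⇒%2≡1 : ∀ n → suc n % 2 ≡ 0 → n % 2 ≡ 1
  suc%2≡0⇒%2≡1 (suc zero)    _  = refl
  suc%2≡0⇒%2≡1 (suc (suc n)) eq = suc%2≡0⇒%2≡1 n eq

  %2≡1⇒suc%2≡0 : ∀ n → n % 2 ≡ 1 → suc n % 2 ≡ 0
  %2≡1⇒suc%2≡0 (suc zero)    _  = refl
  %2≡1⇒suc%2≡0 (suc (suc n)) eq = %2≡1⇒suc%2≡0 n eq

  %2≢suc%2 : ∀ n → n % 2 ≢ suc n % 2
  %2≢suc%2 zero          ()
  %2≢suc%2 (suc zero)    ()
  %2≢suc%2 (suc (suc n)) eq = %2≢suc%2 n eq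

  %2-gap : ∀ {m n} → m % 2 ≡ n % 2 → m < n → 2 + m ≤ n
  %2-gap {m} eq m<n = ≤∧≢⇒< m<n (λ { refl → %2≢suc%2 m eq })


-- Optimal codes and the isometry between them

module Optimal {q : ℕ} (F : FiniteField q) (v : ℕ) where
  open LinearAlgebra F
  open Duality F
  open Levels F v
  private
    S = Subspaces v

  ∣∣-cong : ∀ (C D : Code v) → C ≈ᶜ D → ∣ C ∣ ≡ ∣ D ∣
  ∣∣-cong C D C≈D = trans (∣∣-∑ C) (trans
    (∑-cong reps (λ X → ⟦⟧-cong (X ∈ᶜ? C) (X ∈ᶜ? D) (subst T (C≈D X)) (subst T (sym (C≈D X))))) (sym (∣∣-∑ D)))
    where open Finite S

  MinDistance≥-resp : ∀ d (C D : Code v) → C ≈ᶜ D → MinDistance≥ d C → MinDistance≥ d D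
  MinDistance≥-resp d C D C≈D far X Y X∈ Y∈ =
    far X Y (subst T (sym (C≈D X)) X∈) (subst T (sym (C≈D Y)) Y∈)

  A-≡ : ∀ d (P : Code v) → MinDistance≥ d P → (∀ C → MinDistance≥ d C → ∣ C ∣ ≤ ∣ P ∣) → A v d ≡ ∣ P ∣
  A-≡ d P far bound = ≤-antisym
    (max≤v⁺ z≤n (All.map⁺ (All.map (λ {C} → bound C) (All.all-filter (minDistance≥? d) codes))))
    (v≤max⁺ 0 _ (inj₂ (Any.map⁺ attained)))
    where
    codes = FiniteSetoid.elements (Codes v)
    -- The list of all codes contains `P` only up to `≈ᶜ`; the maximum is attained at an equal code
    -- `C`, to which distance and size are transferred.
    attained : Any.Any (λ C → ∣ P ∣ ≤ ∣ C ∣) (filter (minDistance≥? d) codes)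
    attained = let (C , C∈ , P≈C) = find (FiniteSetoid.complete (Codes v) P) in
      Any.map (λ { refl → ≤-reflexive (∣∣-cong P C P≈C) })
        (∈ˡ.∈-filter⁺ (minDistance≥? d) C∈ (MinDistance≥-resp d P C P≈C far))

  ∈-parityCode⁻ : ∀ k X → _∈_ {S} X (parityCode v k) → dim X % 2 ≡ k % 2
  ∈-parityCode⁻ k X = does⁻ (≡?-mod2 k (dim X))

  ∈-parityCode⁺ : ∀ k X → dim X % 2 ≡ k % 2 → _∈_ {S} X (parityCode v k)
  ∈-parityCode⁺ k X = does⁺ (≡?-mod2 k (dim X))

  -- Distinct subspaces of equal dimension gain a dimension in the sum and lose one in the
  -- intersection. Otherwise parity separates the dimensions by at least two.
  parityCode-far : ∀ k → MinDistance≥ 2 (parityCode v k)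
  parityCode-far k X Y X∈ Y∈ X≉Y = m+n≤o⇒m≤o∸n 2 (cases (<-cmp (dim X) (dim Y)))
    where
    parity≡ : dim X % 2 ≡ dim Y % 2
    parity≡ = trans (∈-parityCode⁻ k X X∈) (sym (∈-parityCode⁻ k Y Y∈))
    cases : Tri (dim X < dim Y) (dim X ≡ dim Y) (dim Y < dim X) → 2 + dim (X ⊓ Y) ≤ dim (X ⊔ Y)
    cases (tri< X<Y _ _) = ≤-trans (+-monoʳ-≤ 2 (dim-mono (X ⊓ Y) X (⊓ˢ-⊆ˡ X Y)))
      (≤-trans (%2-gap parity≡ X<Y) (dim-mono Y (X ⊔ Y) (⊔ˢ-⊆ʳ X Y)))
    cases (tri> _ _ Y<X) = ≤-trans (+-monoʳ-≤ 2 (dim-mono (X ⊓ Y) Y (⊓ˢ-⊆ʳ X Y)))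
      (≤-trans (%2-gap (sym parity≡) Y<X) (dim-mono X (X ⊔ Y) (⊔ˢ-⊆ˡ X Y)))
    cases (tri≈ _ X≡Y _) = ≤-trans
      (s≤s (dim-< (X ⊓ Y) X (⊓ˢ-⊆ˡ X Y) (λ eq → X≉Y (dim-tight X Y
        (λ x x∈ → ⊓ˢ-⊆ʳ X Y x (≈⇒⊆ X (X ⊓ Y) (λ z → sym (eq z)) x x∈)) X≡Y))))
      (dim-< X (X ⊔ Y) (⊔ˢ-⊆ˡ X Y) (λ eq → X≉Y (λ x → sym (dim-tight Y X
        (λ y y∈ → ≈⇒⊆ (X ⊔ Y) X (λ z → sym (eq z)) y (⊔ˢ-⊆ʳ X Y y y∈)) (sym X≡Y) x))))

  perp-isometry : Isometry v
  perp-isometry = record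
    { bijection = record
      { to        = perp
      ; cong      = λ {X} {Y} → perp-cong X Y
      ; bijective = (λ {X} {Y} eq x → trans (perp-involutive X x) (trans (perp-cong (perp X) (perp Y) eq x) (sym (perp-involutive Y x))))
                  , (λ Y → perp Y , λ {X} X≈ x → trans (perp-cong X (perp Y) X≈ x) (sym (perp-involutive Y x)))
      }
    ; isometric = dₛ-perp
    }

  module EvenDimension (k : ℕ) (v≡ : v ≡ k + k) where

    bound : ∀ C → MinDistance≥ 2 C → ∣ C ∣ ≤ ∣ parityCode v k ∣
    bound C far = subst₂ _≤_ (sym (∣∣-levels C)) (sym (trans (∣parityCode∣ k) (gaussianSum-∑ k)))
      (EvenCase.even-bound q q≥2 {k} v≡ (levelCounts C far))

    A≡ : A v 2 ≡ ∣ parityCode v k ∣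
    A≡ = A-≡ 2 (parityCode v k) (parityCode-far k) bound

    unique : ∀ (C : Code v) → (MinDistance≥ 2 C × ∣ C ∣ ≡ A v 2) ⇔ C ≈ᶜ parityCode v k
    unique C = mk⇔
      (λ (far , eq) → levels⇒≈ k C (EvenCase.even-unique q q≥2 {k} v≡ (levelCounts C far)
        (trans (sym (∣∣-levels C)) (trans eq (trans A≡ (trans (∣parityCode∣ k) (gaussianSum-∑ k)))))))
      (λ C≈ → MinDistance≥-resp 2 (parityCode v k) C (λ X → sym (C≈ X)) (parityCode-far k)
            , trans (∣∣-cong C (parityCode v k) C≈) (sym A≡))

  module OddDimension (k : ℕ) (v≡ : v ≡ suc (k + k)) where

    gaussianSum-≡ : gaussianSum v 0 ≡ gaussianSum v 1
    gaussianSum-≡ = trans (gaussianSum-∑ 0) (trans (odd-target 0) (trans (sym (odd-target 1)) (sym (gaussianSum-∑ 1))))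
      -- `odd-target` speaks of the Gaussian binomials alone; the even code supplies the
      -- `LevelCounts` from which it is obtained.
      where open OddCase q q≥2 {k} v≡ (levelCounts (parityCode v 0) (parityCode-far 0))

    bound : ∀ C → MinDistance≥ 2 C → ∣ C ∣ ≤ ∣ parityCode v 0 ∣
    bound C far = subst₂ _≤_ (sym (∣∣-levels C)) (sym (trans (∣parityCode∣ 0) (gaussianSum-∑ 0)))
      (OddCase.odd-bound q q≥2 {k} v≡ (levelCounts C far) 0)

    -- Stated for a variable parity, so that the maximum can be identified with the size of either
    -- optimal code.
    A≡ : ∀ j → gaussianSum v j ≡ gaussianSum v 0 → A v 2 ≡ ∣ parityCode v j ∣
    A≡ j eq = trans (A-≡ 2 (parityCode v 0) (parityCode-far 0) bound)
      (trans (∣parityCode∣ 0) (trans (sym eq) (sym (∣parityCode∣ j))))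

    unique : ∀ (C : Code v) → (MinDistance≥ 2 C × ∣ C ∣ ≡ A v 2) ⇔ (C ≈ᶜ parityCode v 0 ⊎ C ≈ᶜ parityCode v 1)
    unique C = mk⇔ to from
      where
      to : MinDistance≥ 2 C × ∣ C ∣ ≡ A v 2 → C ≈ᶜ parityCode v 0 ⊎ C ≈ᶜ parityCode v 1
      to (far , eq) = Sum.map (levels⇒≈ 0 C) (levels⇒≈ 1 C) (OddCase.odd-unique q q≥2 {k} v≡ (levelCounts C far)
        (trans (sym (∣∣-levels C)) (trans eq (trans (A≡ 0 refl) (trans (∣parityCode∣ 0) (gaussianSum-∑ 0))))))
      attains : ∀ j → gaussianSum v j ≡ gaussianSum v 0 → C ≈ᶜ parityCode v j → MinDistance≥ 2 C × ∣ C ∣ ≡ A v 2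
      attains j eq C≈ = MinDistance≥-resp 2 (parityCode v j) C (λ X → sym (C≈ X)) (parityCode-far j)
        , trans (∣∣-cong C (parityCode v j) C≈) (sym (A≡ j eq))
      from : C ≈ᶜ parityCode v 0 ⊎ C ≈ᶜ parityCode v 1 → MinDistance≥ 2 C × ∣ C ∣ ≡ A v 2
      from (inj₁ C≈) = attains 0 refl C≈
      from (inj₂ C≈) = attains 1 (sym gaussianSum-≡) C≈

    distinct : ¬ (parityCode v 0 ≈ᶜ parityCode v 1)
    distinct eq = 0≢1+n (trans (sym (cong (_% 2) (dim-Zero {v})))
      (∈-parityCode⁻ 1 Zero (subst T (eq Zero) (∈-parityCode⁺ 0 Zero (cong (_% 2) (dim-Zero {v}))))))

    isomorphic : Isomorphic (parityCode v 0) (parityCode v 1)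
    isomorphic = perp-isometry , λ Y → mk⇔
      (λ Y∈ → perp Y , ∈-parityCode⁺ 0 (perp Y) (trans
          (flip (perp Y) Y (trans (+-comm (dim (perp Y)) (dim Y)) (dim-perp-+ Y)))
          (%2≡1⇒suc%2≡0 (dim Y) (∈-parityCode⁻ 1 Y Y∈)))
        , λ x → sym (perp-involutive Y x))
      (λ (X , X∈ , perpX≈Y) → ∈-resp {S} (parityCode v 1) {perp X} {Y} perpX≈Y
        (∈-parityCode⁺ 1 (perp X) (suc%2≡0⇒%2≡1 (dim (perp X))
          (trans (sym (flip X (perp X) (dim-perp-+ X))) (∈-parityCode⁻ 0 X X∈)))))
      where
      -- With v = 2 k + 1 one has dim X + (dim Y + 1) = 2 (k + 1), so complementary dimensions have
      -- opposite parity.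
      flip : ∀ X Y → dim X + dim Y ≡ v → dim X % 2 ≡ suc (dim Y) % 2
      flip X Y eq = %2-+ (dim X) (suc (dim Y)) (suc k)
        (trans (+-suc (dim X) (dim Y)) (cong suc (trans eq (trans v≡ (sym (+-suc k k))))))

mainTheorem13 : ∀ {q : ℕ} (F : FiniteField q) (v k : ℕ) → let open VectorSpace F in
    (v ≡ 2 * k →
    A v 2 ≡ gaussianSum v k
    × (∀ (C : Code v) → (MinDistance≥ 2 C × ∣ C ∣ ≡ A v 2) ⇔ C ≈ᶜ parityCode v k))
    ×
    (v ≡ 2 * k + 1 →
    A v 2 ≡ gaussianSum v 0
    × gaussianSum v 0 ≡ gaussianSum v 1
    × (∀ (C : Code v) → (MinDistance≥ 2 C × ∣ C ∣ ≡ A v 2) ⇔ (C ≈ᶜ parityCode v 0 ⊎ C ≈ᶜ parityCode v 1))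
    × ¬ (parityCode v 0 ≈ᶜ parityCode v 1)
    × Isomorphic (parityCode v 0) (parityCode v 1))
mainTheorem13 F v k =
  (λ v≡ → let open EvenDimension k (trans v≡ double) in
    trans A≡ (∣parityCode∣ k) , unique) ,
  (λ v≡ → let open OddDimension k (trans v≡ (trans (+-comm (2 * k) 1) (cong suc double))) in
    trans (A≡ 0 refl) (∣parityCode∣ 0) , gaussianSum-≡ , unique , distinct , isomorphic)
  where
  open Optimal F v
  open Levels F v using (∣parityCode∣)
  double : 2 * k ≡ k + k
  double = cong (k +_) (+-identityʳ k)
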